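{- Every flotilla $H$ satisfies the Erdős–Hajnal Conjecture: there exists $\epsilon(H)>0$ such that every $H$-free tournament $T$ with $n$ vertices contains a transitive subtournament with at least $n^{\epsilon(H)}$ vertices.
   Context: A tournament is a digraph in which for every pair of distinct vertices $u,v$ exactly one of the arcs $(u,v),(v,u)$ is present; it is transitive if it has no directed cycle. $T$ contains $H$ if $H$ is isomorphic to an induced subtournament of $T$; otherwise $T$ is $H$-free. For an ordering $\theta=(v_1,\dots,v_n)$ of $V(T)$, an arc $(v_i,v_j)$ is backward if $i>j$, and $B(T,\theta)$ is the undirected graph on $V(T)$ whose edges are the pairs joined by a backward arc. A left boat in $B(T,\theta)$ is a set $\{v_{i_1},v_{i_2},v_{i_3},v_{i_4}\}$ with $i_1<i_2<i_3<i_4$ and $i_3=i_2+1=i_1+2$ such that the subgraph of $B(T,\theta)$ induced on it has exactly the edges $v_{i_1}v_{i_3}$, $v_{i_1}v_{i_4}$, $v_{i_2}v_{i_4}$. A right boat is defined identically except that $i_4=i_3+1=i_2+2$ instead. A tournament $H$ is a flotilla if there exists an ordering $\theta$ of $V(H)$ such that every connected component of $B(H,\theta)$ is a left boat or a right boat. -}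

module Defs where

open import Data.Nat using (ℕ; zero; suc; _<_; _≤_; _^_)
open import Data.Fin using (Fin; toℕ; inject₁; fromℕ) renaming (zero to fzero; suc to fsuc)
open import Data.Fin.Permutation using (Permutation′; _⟨$⟩ʳ_)
open import Data.Bool using (Bool; true; false; not)
open import Data.Product using (Σ; ∃; _×_; _,_)
open import Data.Sum using (_⊎_)
open import Data.Empty using (⊥)
open import Relation.Nullary using (¬_)
open import Relation.Binary.PropositionalEquality using (_≡_; _≢_)
open import Relation.Binary.Construct.Closure.ReflexiveTransitive using (Star)
open import Function.Definitions using (Injective)
open import Function.Bundles using (_⇔_)

record Tournament (n : ℕ) : Set where
  field
    arc        : Fin n → Fin n → Bool
    irrefl     : ∀ u → arc u u ≡ false
    tournament : ∀ u v → u ≢ v → arc u v ≡ not (arc v u)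
open Tournament public

Arc : ∀ {n} → Tournament n → Fin n → Fin n → Set
Arc T u v = arc T u v ≡ true

Contains : ∀ {n h} → Tournament n → Tournament h → Set
Contains {n} {h} T H =
  Σ (Fin h → Fin n) λ f → Injective _≡_ _≡_ f × (∀ i j → arc H i j ≡ arc T (f i) (f j))

DirectedCycle : ∀ {n} → Tournament n → Set
DirectedCycle {n} T =
  Σ ℕ λ m → Σ (Fin (suc m) → Fin n) λ w →
    (∀ (i : Fin m) → Arc T (w (inject₁ i)) (w (fsuc i))) × Arc T (w (fromℕ m)) (w fzero)

Restrict : ∀ {n k} → Tournament n → (f : Fin k → Fin n) → Injective _≡_ _≡_ f → Tournament k
Restrict T f inj = record
  { arc = λ i j → arc T (f i) (f j)
  ; irrefl = λ i → irrefl T (f i)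
  ; tournament = λ i j i≢j → tournament T (f i) (f j) (λ e → i≢j (inj e))
  }

Transitive : ∀ {n} → Tournament n → Set
Transitive T = ¬ DirectedCycle T

HasTransitiveSub : ∀ {n} → Tournament n → ℕ → Set
HasTransitiveSub {n} T k =
  Σ (Fin k → Fin n) λ f → Σ (Injective _≡_ _≡_ f) λ inj → Transitive (Restrict T f inj)

-- Backward graph and flotillas.
-- An ordering θ of V(H) is a permutation; position p holds vertex θ p.
-- B(H,θ) is described on positions: positions p, q are adjacent iff
-- the arc between θ p and θ q is backward.

BEdge : ∀ {h} → Tournament h → Permutation′ h → Fin h → Fin h → Set
BEdge H θ p q =
  (toℕ p < toℕ q × Arc H (θ ⟨$⟩ʳ q) (θ ⟨$⟩ʳ p)) ⊎
  (toℕ q < toℕ p × Arc H (θ ⟨$⟩ʳ p) (θ ⟨$⟩ʳ q))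

Reach : ∀ {h} → Tournament h → Permutation′ h → Fin h → Fin h → Set
Reach H θ = Star (BEdge H θ)

BoatEdges : ∀ {h} → Tournament h → Permutation′ h → (a b c d : Fin h) → Set
BoatEdges H θ a b c d =
  BEdge H θ a c × BEdge H θ a d × BEdge H θ b d ×
  ¬ BEdge H θ a b × ¬ BEdge H θ b c × ¬ BEdge H θ c d

LeftBoat : ∀ {h} → Tournament h → Permutation′ h → (a b c d : Fin h) → Set
LeftBoat H θ a b c d =
  toℕ b ≡ suc (toℕ a) × toℕ c ≡ suc (toℕ b) × toℕ c < toℕ d × BoatEdges H θ a b c d

RightBoat : ∀ {h} → Tournament h → Permutation′ h → (a b c d : Fin h) → Set
RightBoat H θ a b c d =
  toℕ a < toℕ b × toℕ c ≡ suc (toℕ b) × toℕ d ≡ suc (toℕ c) × BoatEdges H θ a b c d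

ComponentIs : ∀ {h} → Tournament h → Permutation′ h → Fin h → (a b c d : Fin h) → Set
ComponentIs H θ x a b c d =
  ∀ y → Reach H θ x y ⇔ (y ≡ a ⊎ y ≡ b ⊎ y ≡ c ⊎ y ≡ d)

Flotilla : ∀ {h} → Tournament h → Set
Flotilla {h} H =
  Σ (Permutation′ h) λ θ → ∀ (x : Fin h) →
    Σ (Fin h) λ a → Σ (Fin h) λ b → Σ (Fin h) λ c → Σ (Fin h) λ d →
      ComponentIs H θ x a b c d × (LeftBoat H θ a b c d ⊎ RightBoat H θ a b c d)

module Submission where

-- An arbitrary H-free tournament is treated by induction on vertex subsets X: find S ⊆ X transitive with ∣X∣ ≤ ∣S∣^q,
-- for q large in terms of H.  In a minimal failing X, let t^q < ∣X∣ where no transitive set exceeds t.  If S is completely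
-- joined to S′, then ∣S∣ + ∣S′∣ ≤ t; so no two sets of linear size are completely joined to each other.
--
-- Greedy embedding of H yields linear-size blocks D₁, …, D_h, one per position of θ, with few backward arcs between them,
-- and the boats are embedded one at a time into these blocks.  For a left boat one needs a cyclic triangle u → v → w → u in
-- a block A and z in a later block B with z → u, z → v and w → z.  (Right boats are left boats of the reversed tournament.)
-- Suppose there is none.  Then for z in B every strong subset of A ∩ N⁺(z) extends to a module of A inside N⁺(z).
-- Modules of A of size at most ∣A∣/2 contain only transitive sets of size at most t/2, and overlapping ones can be united,
-- so A is partitioned into maximal small modules Kᵢ, and the classes that N⁺(z) hits are transitively ordered.
-- With ωᵢ the size of a large transitive subset of Kᵢ this gives Σ ωᵢ ≤ t over the classes hit by a given z, and, averaging
-- over z, Σ ωᵢbᵢ ≤ t∣B∣ for bᵢ the number of z hitting Kᵢ.  As ∣Kᵢ∣ ≤ ωᵢ^q ≤ ωᵢ²(t/2)^(q-2), the classes with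
-- bᵢ > ωᵢ∣B∣/4t cover at most half of A.  A transitive set of size more than t/2 in the rest is dominated from at most
-- a quarter of B, hence completely joined to a linear part of B, a contradiction.

open import Defs
open import Data.Bool using (Bool; true; false; not)
import Data.Bool as Bool
open import Data.Empty using (⊥; ⊥-elim)
open import Data.Fin using (Fin; toℕ; fromℕ<; inject₁; fromℕ) renaming (zero to fzero; suc to fsuc)
open import Data.Fin.Permutation using (Permutation′; _⟨$⟩ʳ_; _⟨$⟩ˡ_; inverseʳ; inverseˡ)
import Data.Fin.Properties as Fin
import Data.Fin.Subset as Subset
open import Data.Fin.Subset.Properties using (anySubset?) renaming (_∈?_ to _∈ₛ?_)
open import Data.List using (List; []; _∷_; length)
open import Data.List.Membership.Propositional using () renaming (_∈_ to _∈ₗ_)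
open import Data.List.Relation.Unary.Any using (here; there)
open import Data.Nat using (ℕ; zero; suc; _+_; _*_; _<_; _≤_; _^_; z≤n; s≤s; s≤s⁻¹; _≤?_; _<?_; NonZero; >-nonZero; _/_; _%_)
open import Data.Nat.DivMod using (m≡m%n+[m/n]*n; m%n<n; m/n*n≤m; m≥n⇒m/n>0)
open import Data.Nat.Properties
open import Data.Nat.Tactic.RingSolver using (solve-∀)
open import Data.Product using (Σ; ∃; _×_; _,_; proj₁; proj₂)
open import Data.Sum using (_⊎_; inj₁; inj₂; [_,_])
open import Data.Unit using (⊤; tt)
open import Data.Vec using (tabulate)
open import Data.Vec.Properties using (lookup⇒[]=; []=⇒lookup; lookup∘tabulate)
open import Function using (_∘_; id)
open import Function.Bundles using (Equivalence)
open import Function.Definitions using (Injective)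
open import Relation.Binary using (tri<; tri≈; tri>)
open import Relation.Binary.Construct.Closure.ReflexiveTransitive using (ε; _◅_; _◅◅_)
open import Relation.Binary.PropositionalEquality hiding ([_])
open import Relation.Nullary using (¬_; Dec; yes; no; does; _×-dec_; _⊎-dec_; _→-dec_; ¬?)
open import Relation.Nullary.Decidable using (decidable-stable; dec-true; map′)
open import Algebra.Properties.Semiring.Sum +-*-semiring
  using (sum; sum-cong-≗; ∑-comm; ∑-distrib-+; *-distribˡ-sum; *-distribʳ-sum; sum-replicate-zero)

private variable
  n m : ℕ

-- Sums and decidable subsets

sum-mono : ∀ {n} {f g : Fin n → ℕ} → (∀ i → f i ≤ g i) → sum f ≤ sum g
sum-mono {zero} _ = z≤n
sum-mono {suc n} f≤g = +-mono-≤ (f≤g fzero) (sum-mono (λ i → f≤g (fsuc i)))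

sum-zero : ∀ {n} {f : Fin n → ℕ} → (∀ i → f i ≡ 0) → sum f ≡ 0
sum-zero {n} f≡0 = trans (sum-cong-≗ f≡0) (sum-replicate-zero n)

term≤sum : ∀ {n} (f : Fin n → ℕ) i → f i ≤ sum f
term≤sum f fzero = m≤m+n _ _
term≤sum f (fsuc i) = ≤-trans (term≤sum (λ j → f (fsuc j)) i) (m≤n+m _ _)

sum-const : ∀ n c → sum {n} (λ _ → c) ≡ n * c
sum-const zero c = refl
sum-const (suc n) c = cong (c +_) (sum-const n c)

sum-*ˡ : ∀ {n} c (f : Fin n → ℕ) → sum (λ i → c * f i) ≡ c * sum f
sum-*ˡ c f = sym (*-distribˡ-sum c f)

sum-*ʳ : ∀ {n} (f : Fin n → ℕ) c → sum (λ i → f i * c) ≡ sum f * c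
sum-*ʳ f c = sym (*-distribʳ-sum c f)

𝟙 : ∀ {P : Set} → Dec P → ℕ
𝟙 (yes _) = 1
𝟙 (no _)  = 0

𝟙-yes : ∀ {P : Set} (d : Dec P) → P → 𝟙 d ≡ 1
𝟙-yes (yes _) _ = refl
𝟙-yes (no ¬p) p = ⊥-elim (¬p p)

𝟙-no : ∀ {P : Set} (d : Dec P) → ¬ P → 𝟙 d ≡ 0
𝟙-no (yes p) ¬p = ⊥-elim (¬p p)
𝟙-no (no _) _ = refl

𝟙-≤1 : ∀ {P : Set} (d : Dec P) → 𝟙 d ≤ 1
𝟙-≤1 (yes _) = ≤-refl
𝟙-≤1 (no _) = z≤n

𝟙-intro : ∀ {P : Set} (d : Dec P) {k} → (P → 1 ≤ k) → 𝟙 d ≤ k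
𝟙-intro (yes p) h = h p
𝟙-intro (no _) h = z≤n

𝟙-*-mono : ∀ {P : Set} (d : Dec P) {k l} → (P → k ≤ l) → 𝟙 d * k ≤ 𝟙 d * l
𝟙-*-mono (yes p) h = *-monoʳ-≤ 1 (h p)
𝟙-*-mono (no _) h = z≤n

𝟙-× : ∀ {P Q : Set} (d : Dec P) (e : Dec Q) → 𝟙 (d ×-dec e) ≡ 𝟙 d * 𝟙 e
𝟙-× (yes _) (yes _) = refl
𝟙-× (yes _) (no _) = refl
𝟙-× (no _) (yes _) = refl
𝟙-× (no _) (no _) = refl

infix 4 _∈_ _∉_ _∈?_ _⊆_
infixl 6 _∪_ _∖_

-- Decidable predicates rather than bit vectors: members carry their proofs, and a size is a sum of
-- indicators, so that counting arguments become exchanges of sums.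
record DecSet (n : ℕ) : Set₁ where
  field
    Mem  : Fin n → Set
    mem? : ∀ x → Dec (Mem x)
open DecSet public

_∈_ _∉_ : Fin n → DecSet n → Set
x ∈ S = Mem S x
x ∉ S = ¬ (x ∈ S)

_∈?_ : ∀ (x : Fin n) S → Dec (x ∈ S)
x ∈? S = mem? S x

_⊆_ : DecSet n → DecSet n → Set
S ⊆ S′ = ∀ {x} → x ∈ S → x ∈ S′

Disjoint : DecSet n → DecSet n → Set
Disjoint S S′ = ∀ {x} → x ∈ S → x ∈ S′ → ⊥

all ∅ : DecSet n
all = record { Mem = λ _ → ⊤ ; mem? = λ _ → yes tt }
∅ = record { Mem = λ _ → ⊥ ; mem? = λ _ → no (λ ()) }

⟦_⟧ : Fin n → DecSet n
⟦ u ⟧ = record { Mem = λ x → x ≡ u ; mem? = λ x → x Fin.≟ u }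

sep : ∀ (S : DecSet n) {P : Fin n → Set} → (∀ x → Dec (P x)) → DecSet n
sep S {P} P? = record { Mem = λ x → x ∈ S × P x ; mem? = λ x → (x ∈? S) ×-dec P? x }

_∪_ _∖_ : DecSet n → DecSet n → DecSet n
S ∪ S′ = record { Mem = λ x → x ∈ S ⊎ x ∈ S′ ; mem? = λ x → (x ∈? S) ⊎-dec (x ∈? S′) }
S ∖ S′ = sep S (λ x → ¬? (x ∈? S′))

∣_∣ : DecSet n → ℕ
∣ S ∣ = sum (λ x → 𝟙 (x ∈? S))

∣∣-mono : (S S′ : DecSet n) → S ⊆ S′ → ∣ S ∣ ≤ ∣ S′ ∣
∣∣-mono S S′ S⊆S′ = sum-mono λ x → 𝟙-intro (x ∈? S) λ x∈S → ≤-reflexive (sym (𝟙-yes (x ∈? S′) (S⊆S′ x∈S)))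

∣∣-cover : (S A B : DecSet n) → (∀ {x} → x ∈ S → x ∈ A ⊎ x ∈ B) → ∣ S ∣ ≤ ∣ A ∣ + ∣ B ∣
∣∣-cover S A B cov = ≤-trans (sum-mono step) (≤-reflexive (∑-distrib-+ (λ x → 𝟙 (x ∈? A)) (λ x → 𝟙 (x ∈? B))))
  where
  step : ∀ x → 𝟙 (x ∈? S) ≤ 𝟙 (x ∈? A) + 𝟙 (x ∈? B)
  step x = 𝟙-intro (x ∈? S) λ x∈S → [ (λ a → ≤-trans (≤-reflexive (sym (𝟙-yes (x ∈? A) a))) (m≤m+n _ _))
                                    , (λ b → ≤-trans (≤-reflexive (sym (𝟙-yes (x ∈? B) b))) (m≤n+m _ _)) ] (cov x∈S)

∣∣-disjoint : (A B S : DecSet n) → A ⊆ S → B ⊆ S → Disjoint A B → ∣ A ∣ + ∣ B ∣ ≤ ∣ S ∣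
∣∣-disjoint A B S A⊆S B⊆S dis =
  ≤-trans (≤-reflexive (sym (∑-distrib-+ (λ x → 𝟙 (x ∈? A)) (λ x → 𝟙 (x ∈? B))))) (sum-mono step)
  where
  step : ∀ x → 𝟙 (x ∈? A) + 𝟙 (x ∈? B) ≤ 𝟙 (x ∈? S)
  step x with x ∈? A
  ... | yes a rewrite 𝟙-no (x ∈? B) (dis a) | 𝟙-yes (x ∈? S) (A⊆S a) = ≤-refl
  ... | no _  = 𝟙-intro (x ∈? B) λ b → ≤-reflexive (sym (𝟙-yes (x ∈? S) (B⊆S b)))

∣∣-⋃ : (S : DecSet n) (F : Fin m → DecSet n) → (∀ {x} → x ∈ S → ∃ λ i → x ∈ F i) → ∣ S ∣ ≤ sum (λ i → ∣ F i ∣)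
∣∣-⋃ S F cov = ≤-trans (sum-mono λ x → 𝟙-intro (x ∈? S) (λ x∈S → step x (cov x∈S)))
                       (≤-reflexive (∑-comm (λ x i → 𝟙 (x ∈? F i))))
  where
  step : ∀ x → (∃ λ i → x ∈ F i) → 1 ≤ sum (λ i → 𝟙 (x ∈? F i))
  step x (i , x∈F) = ≤-trans (≤-reflexive (sym (𝟙-yes (x ∈? F i) x∈F))) (term≤sum (λ i → 𝟙 (x ∈? F i)) i)

sum-indicator≤1 : ∀ {P : Fin m → Set} (P? : ∀ i → Dec (P i)) → (∀ {i j} → P i → P j → i ≡ j) → sum (λ i → 𝟙 (P? i)) ≤ 1
sum-indicator≤1 {zero} P? _ = z≤n
sum-indicator≤1 {suc m} P? uniq with P? fzero
... | yes p = ≤-reflexive (cong suc (sum-zero λ i → 𝟙-no (P? (fsuc i)) λ pᵢ → Fin.0≢1+n (uniq p pᵢ)))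
... | no _ = sum-indicator≤1 (λ i → P? (fsuc i)) (λ p p′ → Fin.suc-injective (uniq p p′))

∣∣-⨄ : (S : DecSet n) (F : Fin m → DecSet n) → (∀ i → F i ⊆ S) →
      (∀ {i j x} → x ∈ F i → x ∈ F j → i ≡ j) → sum (λ i → ∣ F i ∣) ≤ ∣ S ∣
∣∣-⨄ S F F⊆S uniq = ≤-trans (≤-reflexive (∑-comm (λ i x → 𝟙 (x ∈? F i)))) (sum-mono step)
  where
  step : ∀ x → sum (λ i → 𝟙 (x ∈? F i)) ≤ 𝟙 (x ∈? S)
  step x with x ∈? S
  ... | yes _ = sum-indicator≤1 (λ i → x ∈? F i) uniq
  ... | no x∉S = ≤-reflexive (sum-zero λ i → 𝟙-no (x ∈? F i) (λ x∈F → x∉S (F⊆S i x∈F)))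

double-count : (A : DecSet n) (B : DecSet m) {R : Fin n → Fin m → Set} (R? : ∀ a b → Dec (R a b)) →
  sum (λ a → 𝟙 (a ∈? A) * ∣ sep B (λ b → R? a b) ∣) ≡ sum (λ b → 𝟙 (b ∈? B) * ∣ sep A (λ a → R? a b) ∣)
double-count A B R? = begin
  sum (λ a → 𝟙 (a ∈? A) * ∣ sep B (λ b → R? a b) ∣)
    ≡⟨ sum-cong-≗ (λ a → sym (sum-*ˡ (𝟙 (a ∈? A)) (λ b → 𝟙 ((b ∈? B) ×-dec R? a b)))) ⟩
  sum (λ a → sum (λ b → 𝟙 (a ∈? A) * 𝟙 ((b ∈? B) ×-dec R? a b)))
    ≡⟨ ∑-comm (λ a b → 𝟙 (a ∈? A) * 𝟙 ((b ∈? B) ×-dec R? a b)) ⟩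
  sum (λ b → sum (λ a → 𝟙 (a ∈? A) * 𝟙 ((b ∈? B) ×-dec R? a b)))
    ≡⟨ sum-cong-≗ (λ b → sum-cong-≗ (λ a → swap a b)) ⟩
  sum (λ b → sum (λ a → 𝟙 (b ∈? B) * 𝟙 ((a ∈? A) ×-dec R? a b)))
    ≡⟨ sum-cong-≗ (λ b → sum-*ˡ (𝟙 (b ∈? B)) (λ a → 𝟙 ((a ∈? A) ×-dec R? a b))) ⟩
  sum (λ b → 𝟙 (b ∈? B) * ∣ sep A (λ a → R? a b) ∣) ∎
  where
  open ≡-Reasoning
  shuffle : ∀ x y z → x * (y * z) ≡ y * (x * z)
  shuffle = solve-∀
  swap : ∀ a b → 𝟙 (a ∈? A) * 𝟙 ((b ∈? B) ×-dec R? a b) ≡ 𝟙 (b ∈? B) * 𝟙 ((a ∈? A) ×-dec R? a b)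
  swap a b rewrite 𝟙-× (b ∈? B) (R? a b) | 𝟙-× (a ∈? A) (R? a b) = shuffle (𝟙 (a ∈? A)) (𝟙 (b ∈? B)) (𝟙 (R? a b))

inhabited : (S : DecSet n) → 0 < ∣ S ∣ → ∃ λ x → x ∈ S
inhabited S 0<∣S∣ with Fin.any? (_∈? S)
... | yes e = e
... | no ∄ = ⊥-elim (<-irrefl (sym (sum-zero λ x → 𝟙-no (x ∈? S) (λ x∈S → ∄ (x , x∈S)))) 0<∣S∣)

-- A size bound may be proved with a member of `S` at hand, because an empty `S` satisfies it
-- anyway.
bound-by-inhabitant : (S : DecSet n) (c : ℕ) {k : ℕ} → (∀ {u} → u ∈ S → c * ∣ S ∣ ≤ k) → c * ∣ S ∣ ≤ k
bound-by-inhabitant S c {k} h with 0 <? ∣ S ∣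
... | yes 0<∣S∣ = h (proj₂ (inhabited S 0<∣S∣))
... | no ¬0<∣S∣ = subst (λ s → c * s ≤ k) (sym (n≤0⇒n≡0 (≮⇒≥ ¬0<∣S∣))) (≤-trans (≤-reflexive (*-zeroʳ c)) z≤n)

∣∣≤n : (S : DecSet n) → ∣ S ∣ ≤ n
∣∣≤n {n} S = ≤-trans (sum-mono λ x → 𝟙-≤1 (x ∈? S)) (≤-reflexive (trans (sum-const n 1) (*-identityʳ n)))

∣all∣ : ∣ all {n} ∣ ≡ n
∣all∣ {n} = trans (sum-const n 1) (*-identityʳ n)

∣⟦⟧∣≤1 : (u : Fin n) → ∣ ⟦ u ⟧ ∣ ≤ 1
∣⟦⟧∣≤1 u = sum-indicator≤1 (_∈? ⟦ u ⟧) (λ p q → trans p (sym q))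

1≤∣∣ : (S : DecSet n) {u : Fin n} → u ∈ S → 1 ≤ ∣ S ∣
1≤∣∣ S {u} u∈S = ≤-trans (≤-reflexive (sym (𝟙-yes (u ∈? S) u∈S))) (term≤sum (λ x → 𝟙 (x ∈? S)) u)

∣∣-strict : (S S′ : DecSet n) → S ⊆ S′ → ∀ {u} → u ∈ S′ → u ∉ S → ∣ S ∣ < ∣ S′ ∣
∣∣-strict S S′ S⊆S′ {u} u∈S′ u∉S =
  ≤-trans (≤-trans (≤-reflexive (+-comm 1 ∣ S ∣)) (+-monoʳ-≤ ∣ S ∣ (1≤∣∣ ⟦ u ⟧ refl)))
          (∣∣-disjoint S ⟦ u ⟧ S′ S⊆S′ (λ { refl → u∈S′ }) (λ { u∈S refl → u∉S u∈S }))

∣∣-∖ : (S S′ : DecSet n) → ∣ S ∣ ≤ ∣ S′ ∣ + ∣ S ∖ S′ ∣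
∣∣-∖ S S′ = ∣∣-cover S S′ (S ∖ S′) split
  where
  split : ∀ {x} → x ∈ S → x ∈ S′ ⊎ x ∈ S ∖ S′
  split {x} x∈S with x ∈? S′
  ... | yes p = inj₁ p
  ... | no ¬p = inj₂ (x∈S , ¬p)

private
  tailSet : DecSet (suc n) → DecSet n
  tailSet S = record { Mem = λ x → fsuc x ∈ S ; mem? = λ x → fsuc x ∈? S }

enumerate : (S : DecSet n) → Σ (Fin ∣ S ∣ → Fin n) λ f → Injective _≡_ _≡_ f × (∀ i → f i ∈ S)
enumerate {zero} S = (λ ()) , (λ { {()} }) , (λ ())
enumerate {suc n} S with fzero ∈? S | enumerate (tailSet S)
... | no _ | f , inj , f∈S = fsuc ∘ f , inj ∘ Fin.suc-injective , f∈S
... | yes z∈S | f , inj , f∈S = g , g-inj , g∈S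
  where
  g : Fin (suc ∣ tailSet S ∣) → Fin (suc n)
  g fzero = fzero
  g (fsuc i) = fsuc (f i)
  g-inj : Injective _≡_ _≡_ g
  g-inj {fzero} {fzero} _ = refl
  g-inj {fsuc i} {fsuc j} e = cong fsuc (inj (Fin.suc-injective e))
  g∈S : ∀ i → g i ∈ S
  g∈S fzero = z∈S
  g∈S (fsuc i) = f∈S i

subset-of-size : (S : DecSet n) (s : ℕ) → s ≤ ∣ S ∣ → Σ (DecSet n) λ S′ → S′ ⊆ S × ∣ S′ ∣ ≡ s
subset-of-size {n} S zero _ = ∅ , (λ ()) , sum-zero {n} (λ _ → refl)
subset-of-size {n} S (suc s) s<∣S∣ with subset-of-size S s (<⇒≤ s<∣S∣)
... | S′ , S′⊆S , refl
  with inhabited (S ∖ S′) (+-cancelˡ-≤ ∣ S′ ∣ _ _ (≤-trans (≤-trans (≤-reflexive (+-comm ∣ S′ ∣ 1)) s<∣S∣) (∣∣-∖ S S′)))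
... | u , u∈S , u∉S′ = S′ ∪ ⟦ u ⟧ , sub
    , ≤-antisym (≤-trans (∣∣-cover (S′ ∪ ⟦ u ⟧) S′ ⟦ u ⟧ id) (≤-trans (+-monoʳ-≤ ∣ S′ ∣ (∣⟦⟧∣≤1 u)) (≤-reflexive (+-comm ∣ S′ ∣ 1))))
                (∣∣-strict S′ (S′ ∪ ⟦ u ⟧) inj₁ (inj₂ refl) u∉S′)
  where
  sub : S′ ∪ ⟦ u ⟧ ⊆ S
  sub (inj₁ p) = S′⊆S p
  sub (inj₂ refl) = u∈S

-- Transitive sets and critical vertex sets

^-distribʳ-* : ∀ q a b → (a * b) ^ q ≡ a ^ q * b ^ q
^-distribʳ-* zero a b = refl
^-distribʳ-* (suc q) a b = trans (cong (a * b *_) (^-distribʳ-* q a b)) (shuffle a b (a ^ q) (b ^ q))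
  where
  shuffle : ∀ a b c d → a * b * (c * d) ≡ a * c * (b * d)
  shuffle = solve-∀

least : ∀ {n} {P : Fin n → Set} → (∀ i → Dec (P i)) → ∃ P → ∃ λ i → P i × (∀ j → P j → toℕ i ≤ toℕ j)
least {zero} P? (() , _)
least {suc n} {P} P? (i , pᵢ) with P? fzero
... | yes p₀ = fzero , p₀ , (λ _ _ → z≤n)
... | no ¬p₀ with least (λ j → P? (fsuc j)) (pred i pᵢ)
  where
  pred : ∀ i → P i → ∃ λ j → P (fsuc j)
  pred fzero p = ⊥-elim (¬p₀ p)
  pred (fsuc i) p = i , p
... | j , pⱼ , minⱼ = fsuc j , pⱼ , min
  where
  min : ∀ k → P k → suc (toℕ j) ≤ toℕ k
  min fzero p = ⊥-elim (¬p₀ p)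
  min (fsuc k) p = s≤s (minⱼ k p)

-- Double negations may be moved out of a finite product. With `⊥` as the goal, maximal objects can
-- thus be chosen for all vertices at once without deciding that they exist.
¬¬-choice : ∀ {ℓ n} {P : Fin n → Set ℓ} → (∀ i → (P i → ⊥) → ⊥) → ((∀ i → P i) → ⊥) → ⊥
¬¬-choice {n = zero} _ k = k (λ ())
¬¬-choice {n = suc n} {P} h k =
  h fzero λ p₀ → ¬¬-choice (λ i → h (fsuc i)) λ ps → k λ { fzero → p₀ ; (fsuc i) → ps i }

-- `P` need not be decidable, so the maximum exists only under a double negation. Each strictly
-- larger set costs one unit of `fuel`; once none is left, `S` has full size.
¬¬-maximum : ∀ {ℓ n} (P : DecSet n → Set ℓ) S → P S →
  (∀ S → P S → (∀ S′ → P S′ → ∣ S′ ∣ ≤ ∣ S ∣) → ⊥) → ⊥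
¬¬-maximum {n = n} P S pS k = go n S pS (m≤m+n n ∣ S ∣)
  where
  go : ∀ fuel S → P S → n ≤ fuel + ∣ S ∣ → ⊥
  go zero S pS enough = k S pS λ S′ _ → ≤-trans (∣∣≤n S′) enough
  go (suc fuel) S pS enough = k S pS bound
    where
    bound : ∀ S′ → P S′ → ∣ S′ ∣ ≤ ∣ S ∣
    bound S′ pS′ with ∣ S′ ∣ ≤? ∣ S ∣
    ... | yes le = le
    ... | no ¬le = ⊥-elim (go fuel S′ pS′
            (≤-trans enough (≤-trans (≤-reflexive (sym (+-suc fuel ∣ S ∣))) (+-monoʳ-≤ fuel (≰⇒> ¬le)))))

module _ {n : ℕ} (T : Tournament n) where

  arc? : ∀ u v → Dec (Arc T u v)
  arc? u v = arc T u v Bool.≟ true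

  arc-irrefl : ∀ {u v} → Arc T u v → u ≢ v
  arc-irrefl {u} uv refl with trans (sym uv) (irrefl T u)
  ... | ()

  arc-asym : ∀ {u v} → Arc T u v → ¬ Arc T v u
  arc-asym {u} {v} uv vu with trans (sym uv) (trans (tournament T u v (arc-irrefl uv)) (cong not vu))
  ... | ()

  arc-flip : ∀ {u v} → u ≢ v → ¬ Arc T u v → Arc T v u
  arc-flip {u} {v} u≢v ¬uv with arc T u v in e | tournament T v u (u≢v ∘ sym)
  ... | true  | _  = ⊥-elim (¬uv refl)
  ... | false | vu = vu

  TransitiveOn : DecSet n → Set
  TransitiveOn S = ∀ {x y w} → x ∈ S → y ∈ S → w ∈ S → Arc T x y → Arc T y w → Arc T x w

  Complete : DecSet n → DecSet n → Set
  Complete S S′ = ∀ {x y} → x ∈ S → y ∈ S′ → Arc T x y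

  acyclic⇒transitive : ∀ S → (∀ {x y w} → x ∈ S → y ∈ S → w ∈ S → Arc T x y → Arc T y w → Arc T w x → ⊥) → TransitiveOn S
  acyclic⇒transitive S acyclic {x} {y} {w} x∈ y∈ w∈ xy yw with arc? x w
  ... | yes xw = xw
  ... | no ¬xw = ⊥-elim (acyclic x∈ y∈ w∈ xy yw (arc-flip (λ { refl → arc-asym xy yw }) ¬xw))

  ∪-transitive : ∀ S S′ → TransitiveOn S → TransitiveOn S′ → Complete S S′ → TransitiveOn (S ∪ S′)
  ∪-transitive S S′ tr tr′ c (inj₁ x) _ (inj₂ w) _ _ = c x w
  ∪-transitive S S′ tr tr′ c (inj₁ x) (inj₁ y) (inj₁ w) xy yw = tr x y w xy yw
  ∪-transitive S S′ tr tr′ c (inj₁ x) (inj₂ y) (inj₁ w) xy yw = ⊥-elim (arc-asym yw (c w y))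
  ∪-transitive S S′ tr tr′ c (inj₂ x) (inj₁ y) _ xy yw = ⊥-elim (arc-asym xy (c y x))
  ∪-transitive S S′ tr tr′ c (inj₂ x) (inj₂ y) (inj₁ w) xy yw = ⊥-elim (arc-asym yw (c w y))
  ∪-transitive S S′ tr tr′ c (inj₂ x) (inj₂ y) (inj₂ w) xy yw = tr′ x y w xy yw

  -- A minimal counterexample `X` for the exponent `q`: `t` caps its transitive sets, yet every
  -- smaller subset meets the bound. The last field makes subsets of linear size nonempty.
  record Critical (X : DecSet n) (q t : ℕ) : Set₁ where
    field
      bounded : ∀ S → S ⊆ X → TransitiveOn S → ∣ S ∣ ≤ t
      smaller : ∀ Y → Y ⊆ X → ∣ Y ∣ < ∣ X ∣ → Σ (DecSet n) λ S → S ⊆ Y × TransitiveOn S × ∣ Y ∣ ≤ ∣ S ∣ ^ q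
      t^q<∣X∣ : t ^ q < ∣ X ∣
      2^q≤∣X∣ : 2 ^ q ≤ ∣ X ∣

module CriticalProperties {n : ℕ} (T : Tournament n) {X : DecSet n} {q t : ℕ} (crit : Critical T X q t) where
  open Critical crit public

  -- The union of the two is again transitive, so both share the budget `t`.
  complete-sum : ∀ S S′ → S ⊆ X → S′ ⊆ X → TransitiveOn T S → TransitiveOn T S′ → Complete T S S′ → ∣ S ∣ + ∣ S′ ∣ ≤ t
  complete-sum S S′ S⊆X S′⊆X tr tr′ c =
    ≤-trans (∣∣-disjoint S S′ (S ∪ S′) inj₁ inj₂ λ x∈S x∈S′ → arc-irrefl T (c x∈S x∈S′) refl)
            (bounded (S ∪ S′) [ S⊆X , S′⊆X ] (∪-transitive T S S′ tr tr′ c))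

  ^*-scale : ∀ c → 2 ^ q * c ^ q ≡ (2 * c) ^ q
  ^*-scale c = sym (^-distribʳ-* q 2 c)

  -- Minimality gives `S` with `∣ Y ∣ ≤ ∣ S ∣ ^ q`; if `2 * ∣ S ∣ ≤ t`, then
  -- `∣ X ∣ ≤ (2 * ∣ S ∣) ^ q ≤ t ^ q`. Thus a fraction `1 / 2 ^ q` of `X` already yields more than
  -- half of the cap `t`.
  half : ∀ Y → Y ⊆ X → ∣ Y ∣ < ∣ X ∣ → ∣ X ∣ ≤ 2 ^ q * ∣ Y ∣ →
    Σ (DecSet n) λ S → S ⊆ Y × TransitiveOn T S × t < 2 * ∣ S ∣
  half Y Y⊆X Y<X large = let S , S⊆Y , tr , Y≤S^q = smaller Y Y⊆X Y<X in S , S⊆Y , tr , ≰⇒> (too-small S Y≤S^q)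
    where
    open ≤-Reasoning
    too-small : ∀ S → ∣ Y ∣ ≤ ∣ S ∣ ^ q → ¬ (2 * ∣ S ∣ ≤ t)
    too-small S Y≤S^q 2S≤t = <-irrefl refl (begin-strict
      t ^ q              <⟨ t^q<∣X∣ ⟩
      ∣ X ∣              ≤⟨ large ⟩
      2 ^ q * ∣ Y ∣      ≤⟨ *-monoʳ-≤ (2 ^ q) Y≤S^q ⟩
      2 ^ q * ∣ S ∣ ^ q  ≡⟨ ^*-scale ∣ S ∣ ⟩
      (2 * ∣ S ∣) ^ q    ≤⟨ ^-monoˡ-≤ q 2S≤t ⟩
      t ^ q              ∎)

  two-halves : ∀ a b → a + b ≤ t → t < 2 * a → 2 * b ≤ t
  two-halves a b a+b≤t t<2a = +-cancelˡ-≤ t _ _ (begin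
    t + 2 * b      ≤⟨ +-monoˡ-≤ (2 * b) (<⇒≤ t<2a) ⟩
    2 * a + 2 * b  ≡⟨ sym (*-distribˡ-+ 2 a b) ⟩
    2 * (a + b)    ≤⟨ *-monoʳ-≤ 2 a+b≤t ⟩
    2 * t          ≡⟨ cong (t +_) (+-identityʳ t) ⟩
    t + t          ∎)
    where open ≤-Reasoning

-- Boats in a pair of blocks

-- `q` is `2 + q′` because two factors `ω` are split off from `ω ^ q`. The factor 64 is slack that
-- covers taking quarters of a block and discarding its heavy classes; `sparse` keeps every module
-- inside an out-neighbourhood of `z` small.
module BoatFree {n : ℕ} (T : Tournament n) {X : DecSet n} {q′ t : ℕ} (crit : Critical T X (2 + q′) t)
  (A B : DecSet n) (A⊆X : A ⊆ X) (B⊆X : B ⊆ X) (A∩B≡∅ : Disjoint A B)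
  (A-large : 64 * ∣ X ∣ ≤ 2 ^ (2 + q′) * ∣ A ∣) (B-large : 64 * ∣ X ∣ ≤ 2 ^ (2 + q′) * ∣ B ∣)
  (sparse : ∀ {z} → z ∈ B → 2 * ∣ sep A (λ a → arc? T z a) ∣ ≤ ∣ A ∣)
  (no-boat : ∀ {u v w z} → u ∈ A → v ∈ A → w ∈ A → z ∈ B → Arc T u v → Arc T v w → Arc T w u →
             Arc T z u → Arc T z v → Arc T w z → ⊥) where

  open CriticalProperties T crit

  q : ℕ
  q = 2 + q′

  N : ℕ
  N = ∣ X ∣

  instance
    2^q≢0 : NonZero (2 ^ q)
    2^q≢0 = m^n≢0 2 q

  64≤ : ∀ {Y : DecSet n} → 64 * N ≤ 2 ^ q * ∣ Y ∣ → 64 ≤ ∣ Y ∣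
  64≤ {Y} large = *-cancelˡ-≤ (2 ^ q) (≤-trans (≤-reflexive (*-comm (2 ^ q) 64)) (≤-trans (*-monoʳ-≤ 64 2^q≤∣X∣) large))

  ∣A∣+∣B∣≤N : ∣ A ∣ + ∣ B ∣ ≤ N
  ∣A∣+∣B∣≤N = ∣∣-disjoint A B X A⊆X B⊆X A∩B≡∅

  0<∣A∣ : 0 < ∣ A ∣
  0<∣A∣ = ≤-trans (s≤s z≤n) (64≤ {A} A-large)

  0<∣B∣ : 0 < ∣ B ∣
  0<∣B∣ = ≤-trans (s≤s z≤n) (64≤ {B} B-large)

  ∣A∣<N : ∣ A ∣ < N
  ∣A∣<N = ≤-trans (≤-trans (≤-reflexive (+-comm 1 ∣ A ∣)) (+-monoʳ-≤ ∣ A ∣ 0<∣B∣)) ∣A∣+∣B∣≤N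

  ∣B∣<N : ∣ B ∣ < N
  ∣B∣<N = ≤-trans (+-monoˡ-≤ ∣ B ∣ 0<∣A∣) ∣A∣+∣B∣≤N

  half-of : ∀ Y W → Y ⊆ W → W ⊆ X → ∣ W ∣ < N → 64 * N ≤ 2 ^ q * ∣ W ∣ → ∣ W ∣ ≤ 4 * ∣ Y ∣ →
    Σ (DecSet n) λ S → S ⊆ Y × TransitiveOn T S × t < 2 * ∣ S ∣
  half-of Y W Y⊆W W⊆X W<N W-large W≤4Y = half Y (W⊆X ∘ Y⊆W) (≤-<-trans (∣∣-mono Y W Y⊆W) W<N)
    (*-cancelˡ-≤ 4 (begin
      4 * N                  ≤⟨ *-monoˡ-≤ N (m≤m+n 4 60) ⟩
      64 * N                 ≤⟨ W-large ⟩
      2 ^ q * ∣ W ∣          ≤⟨ *-monoʳ-≤ (2 ^ q) W≤4Y ⟩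
      2 ^ q * (4 * ∣ Y ∣)    ≡⟨ swap (2 ^ q) ∣ Y ∣ ⟩
      4 * (2 ^ q * ∣ Y ∣)    ∎))
    where
    open ≤-Reasoning
    swap : ∀ a b → a * (4 * b) ≡ 4 * (a * b)
    swap = solve-∀

  -- A module (homogeneous set) of `A`. `uniform` speaks of arcs into `M` only; arcs out of `M`
  -- follow in `uniform′`, since one of two opposite arcs is always present.
  record SmallModule (M : DecSet n) : Set where
    field
      ⊆A      : M ⊆ A
      uniform : ∀ {x u v} → x ∈ A → x ∉ M → u ∈ M → v ∈ M → Arc T x u → Arc T x v
      small   : 2 * ∣ M ∣ ≤ ∣ A ∣

    uniform′ : ∀ {x u v} → x ∈ A → x ∉ M → u ∈ M → v ∈ M → Arc T u x → Arc T v x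
    uniform′ {x} {u} {v} x∈A x∉M u∈M v∈M ux with arc? T v x
    ... | yes vx = vx
    ... | no ¬vx = ⊥-elim (arc-asym T ux
            (uniform x∈A x∉M v∈M u∈M (arc-flip T (λ { refl → x∉M v∈M }) ¬vx)))
  open SmallModule

  -- Fix `u ∈ S`. The vertices of `A` outside `M`, at least half of `A`, split into in- and
  -- out-neighbours of `u`, and the larger part, at least a quarter of `A`, holds a transitive set
  -- of more than `t / 2` vertices. Uniformity joins it completely to `S`.
  module-transitive-half : ∀ {M} → SmallModule M → ∀ S → S ⊆ M → TransitiveOn T S → 2 * ∣ S ∣ ≤ t
  module-transitive-half {M} mod S S⊆M tr = bound-by-inhabitant S 2 λ u∈S → split-at u∈S
    where
    split-at : ∀ {u} → u ∈ S → 2 * ∣ S ∣ ≤ t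
    split-at {u} u∈S = [ into , out ] (≤-total ∣ Out ∣ ∣ In ∣)
      where
      In Out : DecSet n
      In  = sep (A ∖ M) (λ x → arc? T x u)
      Out = sep (A ∖ M) (λ x → arc? T u x)

      ∣A∖M∣≤ : ∣ A ∖ M ∣ ≤ ∣ In ∣ + ∣ Out ∣
      ∣A∖M∣≤ = ∣∣-cover (A ∖ M) In Out split
        where
        split : ∀ {x} → x ∈ A ∖ M → x ∈ In ⊎ x ∈ Out
        split {x} x∈ with arc? T x u
        ... | yes xu = inj₁ (x∈ , xu)
        ... | no ¬xu = inj₂ (x∈ , arc-flip T (λ { refl → proj₂ x∈ (S⊆M u∈S) }) ¬xu)

      ∣A∣≤ : ∀ {k} → ∣ In ∣ + ∣ Out ∣ ≤ 2 * k → ∣ A ∣ ≤ 4 * k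
      ∣A∣≤ {k} le = +-cancelˡ-≤ ∣ A ∣ _ _ (begin
        ∣ A ∣ + ∣ A ∣                                        ≤⟨ +-mono-≤ (∣∣-∖ A M) (∣∣-∖ A M) ⟩
        ∣ M ∣ + ∣ A ∖ M ∣ + (∣ M ∣ + ∣ A ∖ M ∣)              ≡⟨ regroup ∣ M ∣ ∣ A ∖ M ∣ ⟩
        2 * ∣ M ∣ + 2 * ∣ A ∖ M ∣                            ≤⟨ +-mono-≤ (small mod) (*-monoʳ-≤ 2 (≤-trans ∣A∖M∣≤ le)) ⟩
        ∣ A ∣ + 2 * (2 * k)                                  ≡⟨ cong (∣ A ∣ +_) (sym (*-assoc 2 2 k)) ⟩
        ∣ A ∣ + 4 * k                                        ∎)
        where
        open ≤-Reasoning
        regroup : ∀ a b → a + b + (a + b) ≡ 2 * a + 2 * b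
        regroup = solve-∀

      double : ∀ k → k + k ≡ 2 * k
      double k = cong (k +_) (sym (+-identityʳ k))

      into : ∣ Out ∣ ≤ ∣ In ∣ → 2 * ∣ S ∣ ≤ t
      into le = let S′ , S′⊆In , tr′ , t<2S′ = half-of In A (proj₁ ∘ proj₁) A⊆X ∣A∣<N A-large
                     (∣A∣≤ {∣ In ∣} (≤-trans (+-monoʳ-≤ ∣ In ∣ le) (≤-reflexive (double ∣ In ∣))))
        in two-halves ∣ S′ ∣ ∣ S ∣
            (complete-sum S′ S (A⊆X ∘ proj₁ ∘ proj₁ ∘ S′⊆In) (A⊆X ∘ ⊆A mod ∘ S⊆M) tr′ tr
              (λ x∈S′ s∈S → let ((x∈A , x∉M) , xu) = S′⊆In x∈S′ in uniform mod x∈A x∉M (S⊆M u∈S) (S⊆M s∈S) xu))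
            t<2S′

      out : ∣ In ∣ ≤ ∣ Out ∣ → 2 * ∣ S ∣ ≤ t
      out le = let S′ , S′⊆Out , tr′ , t<2S′ = half-of Out A (proj₁ ∘ proj₁) A⊆X ∣A∣<N A-large
                    (∣A∣≤ {∣ Out ∣} (≤-trans (+-monoˡ-≤ ∣ Out ∣ le) (≤-reflexive (double ∣ Out ∣))))
        in two-halves ∣ S′ ∣ ∣ S ∣
            (≤-trans (≤-reflexive (+-comm ∣ S′ ∣ ∣ S ∣))
              (complete-sum S S′ (A⊆X ∘ ⊆A mod ∘ S⊆M) (A⊆X ∘ proj₁ ∘ proj₁ ∘ S′⊆Out) tr tr′
                (λ s∈S x∈S′ → let ((x∈A , x∉M) , ux) = S′⊆Out x∈S′ in uniform′ mod x∈A x∉M (S⊆M u∈S) (S⊆M s∈S) ux)))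
            t<2S′

  smaller-in-A : ∀ Y → Y ⊆ A → Σ (DecSet n) λ S → S ⊆ Y × TransitiveOn T S × ∣ Y ∣ ≤ ∣ S ∣ ^ q
  smaller-in-A Y Y⊆A = smaller Y (A⊆X ∘ Y⊆A) (≤-<-trans (∣∣-mono Y A Y⊆A) ∣A∣<N)

  -- A module of size at most ∣A∣/2 has size at most ∣A∣/4: this gap lets overlapping small modules be united.
  small⇒quarter : ∀ {M} → SmallModule M → 4 * ∣ M ∣ ≤ ∣ A ∣
  small⇒quarter {M} mod = let S , S⊆M , tr , M≤S^q = smaller-in-A M (⊆A mod) in *-cancelˡ-≤ (2 ^ q) (begin
    2 ^ q * (4 * ∣ M ∣)        ≡⟨ swap (2 ^ q) ∣ M ∣ ⟩
    4 * (2 ^ q * ∣ M ∣)        ≤⟨ *-monoʳ-≤ 4 (*-monoʳ-≤ (2 ^ q) M≤S^q) ⟩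
    4 * (2 ^ q * ∣ S ∣ ^ q)    ≡⟨ cong (4 *_) (^*-scale ∣ S ∣) ⟩
    4 * (2 * ∣ S ∣) ^ q        ≤⟨ *-monoʳ-≤ 4 (^-monoˡ-≤ q (module-transitive-half mod S S⊆M tr)) ⟩
    4 * t ^ q                  ≤⟨ *-mono-≤ (m≤m+n 4 60) (<⇒≤ t^q<∣X∣) ⟩
    64 * N                     ≤⟨ A-large ⟩
    2 ^ q * ∣ A ∣              ∎)
    where
    open ≤-Reasoning
    swap : ∀ a b → a * (4 * b) ≡ 4 * (a * b)
    swap = solve-∀

  -- An outside vertex sees all of `M` and all of `M′` as it sees the common vertex `u`. Two
  -- quarters of `A` make at most a half.
  ∪-module : ∀ {M M′ u} → SmallModule M → SmallModule M′ → u ∈ M → u ∈ M′ → SmallModule (M ∪ M′)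
  ∪-module {M} {M′} {u} mod mod′ u∈M u∈M′ = record
    { ⊆A = [ ⊆A mod , ⊆A mod′ ]
    ; uniform = λ x∈A x∉ a∈ b∈ xa → from x∈A x∉ b∈ (to x∈A x∉ a∈ xa)
    ; small = begin
        2 * ∣ M ∪ M′ ∣          ≤⟨ *-monoʳ-≤ 2 (∣∣-cover (M ∪ M′) M M′ id) ⟩
        2 * (∣ M ∣ + ∣ M′ ∣)    ≤⟨ *-cancelˡ-≤ 2 (≤-trans (≤-reflexive (regroup ∣ M ∣ ∣ M′ ∣))
                                     (≤-trans (+-mono-≤ (small⇒quarter mod) (small⇒quarter mod′)) (≤-reflexive (double ∣ A ∣)))) ⟩
        ∣ A ∣                   ∎
    }
    where
    open ≤-Reasoning
    regroup : ∀ a b → 2 * (2 * (a + b)) ≡ 4 * a + 4 * b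
    regroup = solve-∀
    double : ∀ a → a + a ≡ 2 * a
    double = solve-∀
    to : ∀ {x a} → x ∈ A → x ∉ M ∪ M′ → a ∈ M ∪ M′ → Arc T x a → Arc T x u
    to x∈A x∉ (inj₁ a∈M) = uniform mod x∈A (x∉ ∘ inj₁) a∈M u∈M
    to x∈A x∉ (inj₂ a∈M′) = uniform mod′ x∈A (x∉ ∘ inj₂) a∈M′ u∈M′
    from : ∀ {x b} → x ∈ A → x ∉ M ∪ M′ → b ∈ M ∪ M′ → Arc T x u → Arc T x b
    from x∈A x∉ (inj₁ b∈M) = uniform mod x∈A (x∉ ∘ inj₁) u∈M b∈M
    from x∈A x∉ (inj₂ b∈M′) = uniform mod′ x∈A (x∉ ∘ inj₂) u∈M′ b∈M′

  singleton-module : ∀ {u} → u ∈ A → SmallModule ⟦ u ⟧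
  singleton-module {u} u∈A = record
    { ⊆A = λ { refl → u∈A }
    ; uniform = λ { _ _ refl refl xa → xa }
    ; small = ≤-trans (*-monoʳ-≤ 2 (∣⟦⟧∣≤1 u)) (≤-trans (m≤m+n 2 62) (64≤ {A} A-large))
    }

  -- Partition of `A` into maximal small modules

  Class : (Fin n → Fin n) → Fin n → DecSet n
  Class cls i = sep A (λ x → cls x Fin.≟ i)

  -- Together the fields make the nonempty classes the maximal small modules of `A`.
  record Partition (cls : Fin n → Fin n) : Set₁ where
    field
      class-module : ∀ i → SmallModule (Class cls i)
      module-class : ∀ {M u v} → SmallModule M → u ∈ M → v ∈ M → cls u ≡ cls v

  ¬¬-partition : (∀ cls → Partition cls → ⊥) → ⊥
  ¬¬-partition k = ¬¬-choice maximal λ max → let open FromMaximal max in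
    k cls (record { class-module = class-module ; module-class = module-class })
    where
    Maximal : Fin n → DecSet n → Set₁
    Maximal u M = SmallModule M × (∀ M′ → SmallModule M′ → u ∈ M′ → M′ ⊆ M)

    MaximalAt : Fin n → Set₁
    MaximalAt u = Σ (DecSet n) λ M → u ∈ M × (u ∈ A → Maximal u M)

    maximal : ∀ u → (MaximalAt u → ⊥) → ⊥
    maximal u k with u ∈? A
    -- A default outside `A`, where no maximality is claimed.
    ... | no u∉A = k (⟦ u ⟧ , refl , λ u∈A → ⊥-elim (u∉A u∈A))
    -- Maximal size suffices: a small module `M′` through `u` unites with `M` to a small module,
    -- which cannot be larger than `M`, so `M′ ⊆ M`.
    ... | yes u∈A = ¬¬-maximum (λ M → SmallModule M × u ∈ M) ⟦ u ⟧ (singleton-module u∈A , refl)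
      λ { M (mod , u∈M) max → k (M , u∈M , λ _ → mod , λ M′ mod′ u∈M′ {x} x∈M′ →
          decidable-stable (x ∈? M) λ x∉M → <-irrefl refl
            (<-≤-trans (∣∣-strict M (M ∪ M′) inj₁ (inj₂ x∈M′) x∉M)
                       (max (M ∪ M′) (∪-module mod mod′ u∈M u∈M′ , inj₁ u∈M)))) }

    module FromMaximal (max : ∀ u → MaximalAt u) where
      Max : Fin n → DecSet n
      Max u = proj₁ (max u)

      self : ∀ u → u ∈ Max u
      self u = proj₁ (proj₂ (max u))

      Max-module : ∀ {u} → u ∈ A → SmallModule (Max u)
      Max-module {u} u∈A = proj₁ (proj₂ (proj₂ (max u)) u∈A)

      Max-max : ∀ {u M} → u ∈ A → SmallModule M → u ∈ M → M ⊆ Max u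
      Max-max {u} {M} u∈A = proj₂ (proj₂ (proj₂ (max u)) u∈A) M

      first : ∀ u → ∃ λ i → i ∈ Max u × (∀ j → j ∈ Max u → toℕ i ≤ toℕ j)
      first u = least (_∈? Max u) (u , self u)

      -- The least vertex of `Max u` is a canonical name of the class: equal maximal modules get
      -- equal names.
      cls : Fin n → Fin n
      cls u = proj₁ (first u)

      module-class : ∀ {M u v} → SmallModule M → u ∈ M → v ∈ M → cls u ≡ cls v
      module-class {M} {u} {v} mod u∈M v∈M = Fin.toℕ-injective
        (≤-antisym (proj₂ (proj₂ (first u)) (cls v) (Maxᵥ⊆Maxᵤ (proj₁ (proj₂ (first v)))))
                   (proj₂ (proj₂ (first v)) (cls u) (Maxᵤ⊆Maxᵥ (proj₁ (proj₂ (first u))))))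
        where
        u∈A = ⊆A mod u∈M
        v∈A = ⊆A mod v∈M
        Maxᵤ⊆Maxᵥ : Max u ⊆ Max v
        Maxᵤ⊆Maxᵥ = Max-max v∈A (Max-module u∈A) (Max-max u∈A mod u∈M v∈M)
        Maxᵥ⊆Maxᵤ : Max v ⊆ Max u
        Maxᵥ⊆Maxᵤ = Max-max u∈A (Max-module v∈A) (Max-max v∈A mod v∈M u∈M)

      class⊆Max : ∀ {i a} → a ∈ Class cls i → Class cls i ⊆ Max a
      class⊆Max {a = a} (a∈A , refl) {b} (b∈A , cls-b≡i) =
        Max-max a∈A (Max-module i∈A) (Max-max i∈A (Max-module a∈A) i∈Max-a (self a))
          (Max-max i∈A (Max-module b∈A) (subst (_∈ Max b) cls-b≡i (proj₁ (proj₂ (first b)))) (self b))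
        where
        i∈Max-a : cls a ∈ Max a
        i∈Max-a = proj₁ (proj₂ (first a))
        i∈A : cls a ∈ A
        i∈A = ⊆A (Max-module a∈A) i∈Max-a

      class-module : ∀ i → SmallModule (Class cls i)
      class-module i = record
        { ⊆A = proj₁
        ; uniform = λ { x∈A x∉ (a∈A , refl) b∈ xa →
            uniform (Max-module a∈A) x∈A
              (λ x∈Max → x∉ (x∈A , module-class (Max-module a∈A) x∈Max (self _)))
              (self _) (class⊆Max (a∈A , refl) b∈) xa }
        ; small = size
        }
        where
        size : 2 * ∣ Class cls i ∣ ≤ ∣ A ∣
        size = bound-by-inhabitant (Class cls i) 2 λ {a} a∈ →
          ≤-trans (*-monoʳ-≤ 2 (∣∣-mono (Class cls i) (Max a) (class⊆Max a∈))) (small (Max-module (proj₁ a∈)))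

  -- Strong connectivity in its cut form, which applies directly to the out-neighbourhood of a
  -- splitting vertex.
  Strong : DecSet n → Set₁
  Strong S = ∀ P {a b} → a ∈ S → a ∈ P → b ∈ S → b ∉ P →
    Σ (Fin n) λ c → Σ (Fin n) λ d → (c ∈ S × c ∈ P) × (d ∈ S × d ∉ P) × Arc T c d

  triangle-strong : ∀ {u v w} → Arc T u v → Arc T v w → Arc T w u → Strong (⟦ u ⟧ ∪ ⟦ v ⟧ ∪ ⟦ w ⟧)
  triangle-strong {u} {v} {w} uv vw wu P {a} {b} a∈ a∈P b∈ b∉P with u ∈? P | v ∈? P | w ∈? P
  ... | yes u∈ | no v∉  | _      = u , v , (inj₁ (inj₁ refl) , u∈) , (inj₁ (inj₂ refl) , v∉) , uv
  ... | _      | yes v∈ | no w∉  = v , w , (inj₁ (inj₂ refl) , v∈) , (inj₂ refl , w∉) , vw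
  ... | no u∉  | _      | yes w∈ = w , u , (inj₂ refl , w∈) , (inj₁ (inj₁ refl) , u∉) , wu
  ... | yes u∈ | yes v∈ | yes w∈ = ⊥-elim (b∉P (all-in b∈))
    where
    all-in : ∀ {y} → y ∈ ⟦ u ⟧ ∪ ⟦ v ⟧ ∪ ⟦ w ⟧ → y ∈ P
    all-in (inj₁ (inj₁ refl)) = u∈
    all-in (inj₁ (inj₂ refl)) = v∈
    all-in (inj₂ refl) = w∈
  ... | no u∉ | no v∉ | no w∉ = ⊥-elim (all-out a∈ a∈P)
    where
    all-out : ∀ {y} → y ∈ ⟦ u ⟧ ∪ ⟦ v ⟧ ∪ ⟦ w ⟧ → y ∉ P
    all-out (inj₁ (inj₁ refl)) = u∉
    all-out (inj₁ (inj₂ refl)) = v∉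
    all-out (inj₂ refl) = w∉

  -- A cut that leaves `S` whole isolates `x` and is crossed by `x → a` or `b → x`; every other cut
  -- already separates `S`.
  extend-strong : ∀ S {x a b} → Strong S → a ∈ S → b ∈ S → Arc T x a → Arc T b x → Strong (S ∪ ⟦ x ⟧)
  extend-strong S {x} {a} {b} strong a∈S b∈S xa bx P = go
    where
    Crossing : Set
    Crossing = Σ (Fin n) λ c → Σ (Fin n) λ d → (c ∈ S ∪ ⟦ x ⟧ × c ∈ P) × (d ∈ S ∪ ⟦ x ⟧ × d ∉ P) × Arc T c d
    inside : ∀ {c d} → c ∈ S → c ∈ P → d ∈ S → d ∉ P → Crossing
    inside c∈S c∈P d∈S d∉P = let c , d , (c∈ , c∈P) , (d∈ , d∉P) , cd = strong P c∈S c∈P d∈S d∉P in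
      c , d , (inj₁ c∈ , c∈P) , (inj₁ d∈ , d∉P) , cd
    go : ∀ {c d} → c ∈ S ∪ ⟦ x ⟧ → c ∈ P → d ∈ S ∪ ⟦ x ⟧ → d ∉ P → Crossing
    go (inj₁ c∈S) c∈P (inj₁ d∈S) d∉P = inside c∈S c∈P d∈S d∉P
    go (inj₂ refl) x∈P (inj₂ refl) x∉P = ⊥-elim (x∉P x∈P)
    go (inj₂ refl) x∈P (inj₁ d∈S) d∉P with a ∈? P
    ... | yes a∈P = inside a∈S a∈P d∈S d∉P
    ... | no a∉P = x , a , (inj₂ refl , x∈P) , (inj₁ a∈S , a∉P) , xa
    go (inj₁ c∈S) c∈P (inj₂ refl) x∉P with b ∈? P
    ... | yes b∈P = b , x , (inj₁ b∈S , b∈P) , (inj₂ refl , x∉P) , bx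
    ... | no b∉P = inside c∈S c∈P b∈S b∉P

  N⁺ : Fin n → DecSet n
  N⁺ z = sep A (λ a → arc? T z a)

  -- If `x → z`, then the triangle `c → d → x → c` together with `z` is a forbidden boat.
  splitter-in-N⁺ : ∀ {z x c d} → z ∈ B → x ∈ A → c ∈ N⁺ z → d ∈ N⁺ z → Arc T x c → Arc T d x → Arc T c d → Arc T z x
  splitter-in-N⁺ {z} {x} z∈B x∈A (c∈A , zc) (d∈A , zd) xc dx cd = decidable-stable (arc? T z x) λ ¬zx →
    no-boat c∈A d∈A x∈A z∈B cd dx xc zc zd (arc-flip T (λ { refl → A∩B≡∅ x∈A z∈B }) ¬zx)

  -- A vertex x splitting a strong S ⊆ N⁺(z) lies on a cyclic triangle x → c → d → x with c, d ∈ S, so x ∈ N⁺(z)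
  -- by boat-freeness; hence a maximal strong subset of N⁺(z) is a module of A.
  triangle-in-N⁺ : ∀ {cls} → Partition cls → ∀ {z u v w} → z ∈ B → u ∈ N⁺ z → v ∈ N⁺ z → w ∈ N⁺ z →
    Arc T u v → Arc T v w → Arc T w u → cls u ≡ cls v
  triangle-in-N⁺ {cls} part {z} {u} {v} {w} z∈B u∈ v∈ w∈ uv vw wu =
    decidable-stable (cls u Fin.≟ cls v) λ cls≢ →
      ¬¬-maximum (λ S → (u ∈ S × v ∈ S) × S ⊆ N⁺ z × Strong S) (⟦ u ⟧ ∪ ⟦ v ⟧ ∪ ⟦ w ⟧)
        ((inj₁ (inj₁ refl) , inj₁ (inj₂ refl))
          , (λ { (inj₁ (inj₁ refl)) → u∈ ; (inj₁ (inj₂ refl)) → v∈ ; (inj₂ refl) → w∈ })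
          , triangle-strong uv vw wu)
        λ { S ((u∈S , v∈S) , S⊆ , strong) max →
            cls≢ (Partition.module-class part (maximal-strong S (u∈S , v∈S) S⊆ strong max) u∈S v∈S) }
    where
    maximal-strong : ∀ S → (u ∈ S × v ∈ S) → S ⊆ N⁺ z → Strong S →
      (∀ S′ → (u ∈ S′ × v ∈ S′) × S′ ⊆ N⁺ z × Strong S′ → ∣ S′ ∣ ≤ ∣ S ∣) → SmallModule S
    maximal-strong S (u∈S , v∈S) S⊆ strong max = record
      { ⊆A = proj₁ ∘ S⊆
      ; uniform = unsplit
      ; small = ≤-trans (*-monoʳ-≤ 2 (∣∣-mono S (N⁺ z) S⊆)) (sparse z∈B)
      }
      where
      unsplit : ∀ {x a b} → x ∈ A → x ∉ S → a ∈ S → b ∈ S → Arc T x a → Arc T x b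
      unsplit {x} {a} {b} x∈A x∉S a∈S b∈S xa = decidable-stable (arc? T x b) λ ¬xb →
        -- Cutting `S` by the out-neighbourhood of `x` yields `c → d` with `x → c` and `d → x`.
        let c , d , (c∈S , xc) , (d∈S , ¬xd) , cd = strong (record { Mem = Arc T x ; mem? = arc? T x }) a∈S xa b∈S ¬xb
            zx = splitter-in-N⁺ z∈B x∈A (S⊆ c∈S) (S⊆ d∈S) xc (arc-flip T (λ x≡d → x∉S (subst (_∈ S) (sym x≡d) d∈S)) ¬xd) cd
            bx = arc-flip T (λ x≡b → x∉S (subst (_∈ S) (sym x≡b) b∈S)) ¬xb
        in <-irrefl refl (<-≤-trans
             (∣∣-strict S (S ∪ ⟦ x ⟧) inj₁ (inj₂ refl) x∉S)
             (max (S ∪ ⟦ x ⟧) ((inj₁ u∈S , inj₁ v∈S) , (λ { (inj₁ y∈S) → S⊆ y∈S ; (inj₂ refl) → x∈A , zx })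
                   , extend-strong S strong a∈S b∈S xa bx)))

  -- Weights of the classes met by an out-neighbourhood

  module Saturation {cls : Fin n → Fin n} (part : Partition cls) (S : Fin n → DecSet n)
    (S⊆K : ∀ i → S i ⊆ Class cls i) (S-transitive : ∀ i → TransitiveOn T (S i))
    (∣K∣≤ω^q : ∀ i → ∣ Class cls i ∣ ≤ ∣ S i ∣ ^ q) where
    open Partition part

    ω : Fin n → ℕ
    ω i = ∣ S i ∣

    2ω≤t : ∀ i → 2 * ω i ≤ t
    2ω≤t i = module-transitive-half (class-module i) (S i) (S⊆K i) (S-transitive i)

    Hit : DecSet n → Fin n → Set
    Hit Z i = ∃ λ x → x ∈ Z × cls x ≡ i

    hit? : ∀ Z i → Dec (Hit Z i)
    hit? Z i = Fin.any? (λ x → (x ∈? Z) ×-dec (cls x Fin.≟ i))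

    move-target : ∀ {x a b} → x ∈ A → a ∈ A → b ∈ A → cls a ≡ cls b → cls x ≢ cls b → Arc T x a → Arc T x b
    move-target {b = b} x∈A a∈A b∈A a~b x≁b =
      uniform (class-module (cls b)) x∈A (x≁b ∘ proj₂) (a∈A , a~b) (b∈A , refl)

    move-source : ∀ {x a b} → x ∈ A → a ∈ A → b ∈ A → cls a ≡ cls b → cls x ≢ cls b → Arc T a x → Arc T b x
    move-source {b = b} x∈A a∈A b∈A a~b x≁b =
      uniform′ (class-module (cls b)) x∈A (x≁b ∘ proj₂) (a∈A , a~b) (b∈A , refl)

    -- Exchanges `Z` for the sets `S i` of all classes that it meets. Between different classes the
    -- arcs agree with those of `Z`, since classes are modules.
    saturate : DecSet n → DecSet n
    saturate Z = sep A {λ x → x ∈ S (cls x) × Hit Z (cls x)} (λ x → (x ∈? S (cls x)) ×-dec hit? Z (cls x))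

    module _ (Z : DecSet n) (Z⊆A : Z ⊆ A)
      (triangles-in-classes : ∀ {u v w} → u ∈ Z → v ∈ Z → w ∈ Z → Arc T u v → Arc T v w → Arc T w u → cls u ≡ cls v) where

      -- A cyclic triangle within one class contradicts the transitivity of `S i`, one meeting
      -- exactly two classes contradicts their being modules, and one meeting three classes moves to
      -- vertices of `Z` in the same classes, where the hypothesis forbids it.
      saturate-transitive : TransitiveOn T (saturate Z)
      saturate-transitive = acyclic⇒transitive T (saturate Z) acyclic
        where
        acyclic : ∀ {x y w} → x ∈ saturate Z → y ∈ saturate Z → w ∈ saturate Z → Arc T x y → Arc T y w → Arc T w x → ⊥
        acyclic {x} {y} {w} (x∈A , x∈S , x′ , x′∈Z , x′~x) (y∈A , y∈S , y′ , y′∈Z , y′~y) (w∈A , w∈S , w′ , w′∈Z , w′~w) xy yw wx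
          with cls x Fin.≟ cls y | cls y Fin.≟ cls w | cls w Fin.≟ cls x
        ... | yes x~y | yes y~w | _ = arc-asym T wx
              (S-transitive (cls x) x∈S (subst (λ i → y ∈ S i) (sym x~y) y∈S)
                 (subst (λ i → w ∈ S i) (sym (trans x~y y~w)) w∈S) xy yw)
        ... | yes x~y | no y≁w | _ = arc-asym T yw (move-target w∈A x∈A y∈A x~y (y≁w ∘ sym) wx)
        ... | no x≁y | yes y~w | _ = arc-asym T wx (move-target x∈A y∈A w∈A y~w (λ e → x≁y (trans e (sym y~w))) xy)
        ... | no x≁y | no y≁w | yes w~x = arc-asym T xy (move-target y∈A w∈A x∈A w~x (x≁y ∘ sym) yw)
        ... | no x≁y | no y≁w | no w≁x = x≁y (trans (sym x′~x) (trans
                (triangles-in-classes x′∈Z y′∈Z w′∈Z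
                  (transport x∈A y∈A x′∈Z y′∈Z x′~x y′~y x≁y xy)
                  (transport y∈A w∈A y′∈Z w′∈Z y′~y w′~w y≁w yw)
                  (transport w∈A x∈A w′∈Z x′∈Z w′~w x′~x w≁x wx)) y′~y))
          where
          transport : ∀ {a b a′ b′} → a ∈ A → b ∈ A → a′ ∈ Z → b′ ∈ Z → cls a′ ≡ cls a → cls b′ ≡ cls b →
            cls a ≢ cls b → Arc T a b → Arc T a′ b′
          transport a∈A b∈A a′∈Z b′∈Z a′~a b′~b a≁b ab =
            move-target (Z⊆A a′∈Z) b∈A (Z⊆A b′∈Z) (sym b′~b) (λ e → a≁b (trans (sym a′~a) (trans e b′~b)))
              (move-source b∈A a∈A (Z⊆A a′∈Z) (sym a′~a) (λ e → a≁b (trans (sym a′~a) (sym e))) ab)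

      weight≤t : sum (λ i → 𝟙 (hit? Z i) * ω i) ≤ t
      weight≤t = ≤-trans (≤-reflexive (sum-cong-≗ expand)) (≤-trans
        (∣∣-⨄ (saturate Z) F F⊆ (λ (x∈Sᵢ , _) (x∈Sⱼ , _) → trans (sym (proj₂ (S⊆K _ x∈Sᵢ))) (proj₂ (S⊆K _ x∈Sⱼ))))
        (bounded (saturate Z) (A⊆X ∘ proj₁) saturate-transitive))
        where
        F : Fin n → DecSet n
        F i = sep (S i) (λ _ → hit? Z i)
        F⊆ : ∀ i → F i ⊆ saturate Z
        F⊆ i (x∈S , hit) with S⊆K i x∈S
        ... | x∈A , refl = x∈A , x∈S , hit
        expand : ∀ i → 𝟙 (hit? Z i) * ω i ≡ ∣ F i ∣
        expand i = trans (sym (sum-*ˡ (𝟙 (hit? Z i)) (λ x → 𝟙 (x ∈? S i))))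
          (sum-cong-≗ (λ x → trans (*-comm (𝟙 (hit? Z i)) (𝟙 (x ∈? S i))) (sym (𝟙-× (x ∈? S i) (hit? Z i)))))


    hits : Fin n → DecSet n
    hits i = sep B (λ z → hit? (N⁺ z) i)

    b : Fin n → ℕ
    b i = ∣ hits i ∣

    -- After exchanging the sums, each `z ∈ B` contributes the weight of the classes that `N⁺ z`
    -- meets, which is at most `t`.
    Σωb≤t∣B∣ : sum (λ i → ω i * b i) ≤ t * ∣ B ∣
    Σωb≤t∣B∣ = begin
      sum (λ i → ω i * b i)
        ≡⟨ sum-cong-≗ (λ i → trans (sym (sum-*ˡ (ω i) (λ z → 𝟙 (z ∈? hits i)))) (sum-cong-≗ (λ z → expand i z))) ⟩
      sum (λ i → sum (λ z → 𝟙 (z ∈? B) * (𝟙 (hit? (N⁺ z) i) * ω i)))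
        ≡⟨ ∑-comm (λ i z → 𝟙 (z ∈? B) * (𝟙 (hit? (N⁺ z) i) * ω i)) ⟩
      sum (λ z → sum (λ i → 𝟙 (z ∈? B) * (𝟙 (hit? (N⁺ z) i) * ω i)))
        ≡⟨ sum-cong-≗ (λ z → sum-*ˡ (𝟙 (z ∈? B)) (λ i → 𝟙 (hit? (N⁺ z) i) * ω i)) ⟩
      sum (λ z → 𝟙 (z ∈? B) * sum (λ i → 𝟙 (hit? (N⁺ z) i) * ω i))
        ≤⟨ sum-mono (λ z → 𝟙-*-mono (z ∈? B) (λ z∈B → weight≤t (N⁺ z) proj₁ (triangle-in-N⁺ part z∈B))) ⟩
      sum (λ z → 𝟙 (z ∈? B) * t)
        ≡⟨ trans (sum-*ʳ (λ z → 𝟙 (z ∈? B)) t) (*-comm ∣ B ∣ t) ⟩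
      t * ∣ B ∣ ∎
      where
      open ≤-Reasoning
      shuffle : ∀ x y z → z * (x * y) ≡ x * (y * z)
      shuffle = solve-∀
      expand : ∀ i z → ω i * 𝟙 (z ∈? hits i) ≡ 𝟙 (z ∈? B) * (𝟙 (hit? (N⁺ z) i) * ω i)
      expand i z = trans (cong (ω i *_) (𝟙-× (z ∈? B) (hit? (N⁺ z) i))) (shuffle (𝟙 (z ∈? B)) (𝟙 (hit? (N⁺ z) i)) (ω i))

    -- This is `b i > ω i ∣ B ∣ / 4t` without division. Light classes are hit so rarely that those
    -- met by one transitive set of light vertices are together hit from at most a quarter of `B`.
    Heavy : Fin n → Set
    Heavy i = ω i * ∣ B ∣ < 4 * t * b i

    heavy? : ∀ i → Dec (Heavy i)
    heavy? i = ω i * ∣ B ∣ <? 4 * t * b i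

    Σ-heavy-ω² : sum (λ i → 𝟙 (heavy? i) * (ω i * ω i)) ≤ 4 * t * t
    Σ-heavy-ω² = *-cancelʳ-≤ _ _ ∣ B ∣ ⦃ >-nonZero 0<∣B∣ ⦄ (begin
      sum (λ i → 𝟙 (heavy? i) * (ω i * ω i)) * ∣ B ∣     ≡⟨ sym (sum-*ʳ (λ i → 𝟙 (heavy? i) * (ω i * ω i)) ∣ B ∣) ⟩
      sum (λ i → 𝟙 (heavy? i) * (ω i * ω i) * ∣ B ∣)     ≤⟨ sum-mono (λ i → termwise i (heavy? i)) ⟩
      sum (λ i → 4 * t * (ω i * b i))                    ≡⟨ sum-*ˡ (4 * t) (λ i → ω i * b i) ⟩
      4 * t * sum (λ i → ω i * b i)                      ≤⟨ *-monoʳ-≤ (4 * t) Σωb≤t∣B∣ ⟩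
      4 * t * (t * ∣ B ∣)                                ≡⟨ sym (*-assoc (4 * t) t ∣ B ∣) ⟩
      4 * t * t * ∣ B ∣                                  ∎)
      where
      open ≤-Reasoning
      termwise : ∀ i (d : Dec (Heavy i)) → 𝟙 d * (ω i * ω i) * ∣ B ∣ ≤ 4 * t * (ω i * b i)
      termwise i (no _) = z≤n
      termwise i (yes heavy) = begin
        1 * (ω i * ω i) * ∣ B ∣     ≡⟨ shuffle (ω i) ∣ B ∣ ⟩
        ω i * (ω i * ∣ B ∣)         ≤⟨ *-monoʳ-≤ (ω i) (<⇒≤ heavy) ⟩
        ω i * (4 * t * b i)         ≡⟨ shuffle′ (ω i) (4 * t) (b i) ⟩
        4 * t * (ω i * b i)         ∎
        where
        shuffle : ∀ x y → 1 * (x * x) * y ≡ x * (x * y)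
        shuffle = solve-∀
        shuffle′ : ∀ x y z → x * (y * z) ≡ y * (x * z)
        shuffle′ = solve-∀

    A-heavy A-light : DecSet n
    A-heavy = sep A (λ x → heavy? (cls x))
    A-light = A ∖ A-heavy

    -- Two of the `q` factors `ω i` are kept for the sum of squares; the other `q′` are each at most
    -- `t / 2`, which yields the saving `2 ^ q′`.
    class-size : ∀ i → 2 ^ q′ * ∣ Class cls i ∣ ≤ ω i * ω i * t ^ q′
    class-size i = begin
      2 ^ q′ * ∣ Class cls i ∣            ≤⟨ *-monoʳ-≤ (2 ^ q′) (∣K∣≤ω^q i) ⟩
      2 ^ q′ * (ω i * (ω i * ω i ^ q′))   ≡⟨ shuffle (2 ^ q′) (ω i) (ω i ^ q′) ⟩
      ω i * ω i * (2 ^ q′ * ω i ^ q′)     ≡⟨ cong (ω i * ω i *_) (sym (^-distribʳ-* q′ 2 (ω i))) ⟩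
      ω i * ω i * (2 * ω i) ^ q′          ≤⟨ *-monoʳ-≤ (ω i * ω i) (^-monoˡ-≤ q′ (2ω≤t i)) ⟩
      ω i * ω i * t ^ q′                  ∎
      where
      open ≤-Reasoning
      shuffle : ∀ x y z → x * (y * (y * z)) ≡ y * y * (x * z)
      shuffle = solve-∀

    ∣A-heavy∣ : 2 ^ q′ * ∣ A-heavy ∣ ≤ 4 * t ^ q
    ∣A-heavy∣ = begin
      2 ^ q′ * ∣ A-heavy ∣
        ≤⟨ *-monoʳ-≤ (2 ^ q′) (∣∣-⋃ A-heavy F (λ {x} (x∈A , heavy) → cls x , (x∈A , refl) , heavy)) ⟩
      2 ^ q′ * sum (λ i → ∣ F i ∣)
        ≡⟨ sym (sum-*ˡ (2 ^ q′) (λ i → ∣ F i ∣)) ⟩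
      sum (λ i → 2 ^ q′ * ∣ F i ∣)
        ≤⟨ sum-mono termwise ⟩
      sum (λ i → 𝟙 (heavy? i) * (ω i * ω i) * t ^ q′)
        ≡⟨ sum-*ʳ (λ i → 𝟙 (heavy? i) * (ω i * ω i)) (t ^ q′) ⟩
      sum (λ i → 𝟙 (heavy? i) * (ω i * ω i)) * t ^ q′
        ≤⟨ *-monoˡ-≤ (t ^ q′) Σ-heavy-ω² ⟩
      4 * t * t * t ^ q′
        ≡⟨ shuffle t (t ^ q′) ⟩
      4 * t ^ q ∎
      where
      open ≤-Reasoning
      F : Fin n → DecSet n
      F i = sep (Class cls i) (λ _ → heavy? i)
      shuffle : ∀ x y → 4 * x * x * y ≡ 4 * (x * (x * y))
      shuffle = solve-∀
      shuffle′ : ∀ x y z → x * (y * z) ≡ z * (x * y)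
      shuffle′ = solve-∀
      termwise : ∀ i → 2 ^ q′ * ∣ F i ∣ ≤ 𝟙 (heavy? i) * (ω i * ω i) * t ^ q′
      termwise i = begin
        2 ^ q′ * ∣ F i ∣                               ≡⟨ cong (2 ^ q′ *_) (trans (sum-cong-≗ (λ x → 𝟙-× (x ∈? Class cls i) (heavy? i)))
                                                            (sum-*ʳ (λ x → 𝟙 (x ∈? Class cls i)) (𝟙 (heavy? i)))) ⟩
        2 ^ q′ * (∣ Class cls i ∣ * 𝟙 (heavy? i))      ≡⟨ shuffle′ (2 ^ q′) ∣ Class cls i ∣ (𝟙 (heavy? i)) ⟩
        𝟙 (heavy? i) * (2 ^ q′ * ∣ Class cls i ∣)      ≤⟨ *-monoʳ-≤ (𝟙 (heavy? i)) (class-size i) ⟩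
        𝟙 (heavy? i) * (ω i * ω i * t ^ q′)            ≡⟨ sym (*-assoc (𝟙 (heavy? i)) (ω i * ω i) (t ^ q′)) ⟩
        𝟙 (heavy? i) * (ω i * ω i) * t ^ q′            ∎

    -- Since `2 ^ q` is four times `2 ^ q′`, the bound on `A-heavy` becomes `32 * t ^ q`, which the
    -- factor 64 in `A-large` absorbs.
    2∣A-heavy∣≤∣A∣ : 2 * ∣ A-heavy ∣ ≤ ∣ A ∣
    2∣A-heavy∣≤∣A∣ = *-cancelˡ-≤ (2 ^ q) (begin
      2 ^ q * (2 * ∣ A-heavy ∣)     ≡⟨ shuffle (2 ^ q′) ∣ A-heavy ∣ ⟩
      8 * (2 ^ q′ * ∣ A-heavy ∣)    ≤⟨ *-monoʳ-≤ 8 ∣A-heavy∣ ⟩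
      8 * (4 * t ^ q)               ≡⟨ sym (*-assoc 8 4 (t ^ q)) ⟩
      32 * t ^ q                    ≤⟨ *-mono-≤ (m≤m+n 32 32) (<⇒≤ t^q<∣X∣) ⟩
      64 * N                        ≤⟨ A-large ⟩
      2 ^ q * ∣ A ∣                 ∎)
      where
      open ≤-Reasoning
      shuffle : ∀ x y → 2 * (2 * x) * (2 * y) ≡ 8 * (x * y)
      shuffle = solve-∀

    ∣A∣≤4∣A-light∣ : ∣ A ∣ ≤ 4 * ∣ A-light ∣
    ∣A∣≤4∣A-light∣ = +-cancelˡ-≤ ∣ A ∣ _ _ (begin
      ∣ A ∣ + ∣ A ∣                          ≡⟨ double ∣ A ∣ ⟩
      2 * ∣ A ∣                              ≤⟨ *-monoʳ-≤ 2 (∣∣-∖ A A-heavy) ⟩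
      2 * (∣ A-heavy ∣ + ∣ A-light ∣)        ≡⟨ *-distribˡ-+ 2 ∣ A-heavy ∣ ∣ A-light ∣ ⟩
      2 * ∣ A-heavy ∣ + 2 * ∣ A-light ∣      ≤⟨ +-mono-≤ 2∣A-heavy∣≤∣A∣ (*-monoˡ-≤ ∣ A-light ∣ (m≤m+n 2 2)) ⟩
      ∣ A ∣ + 4 * ∣ A-light ∣                ∎)
      where
      open ≤-Reasoning
      double : ∀ a → a + a ≡ 2 * a
      double = solve-∀

    module Light (L : DecSet n) (L⊆ : L ⊆ A-light) (L-transitive : TransitiveOn T L) (t<2L : t < 2 * ∣ L ∣) where

      dominator? : ∀ z → Dec (∃ λ x → x ∈ L × Arc T z x)
      dominator? z = Fin.any? (λ x → (x ∈? L) ×-dec arc? T z x)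

      N⁻L : DecSet n
      N⁻L = sep B dominator?

      L-triangle-free : ∀ {u v w} → u ∈ L → v ∈ L → w ∈ L → Arc T u v → Arc T v w → Arc T w u → cls u ≡ cls v
      L-triangle-free u∈ v∈ w∈ uv vw wu = ⊥-elim (arc-asym T wu (L-transitive u∈ v∈ w∈ uv vw))

      0<t : 0 < t
      0<t = ≤-trans (*-cancelˡ-< 2 0 ∣ L ∣ (≤-<-trans z≤n t<2L)) (bounded L (A⊆X ∘ proj₁ ∘ L⊆) L-transitive)

      -- Each `z` in `N⁻L` hits a class that `L` meets, and such a class is light. Applying
      -- `weight≤t` with `L` itself in the place of `Z` bounds the total weight of these classes.
      4∣N⁻L∣≤∣B∣ : 4 * ∣ N⁻L ∣ ≤ ∣ B ∣
      4∣N⁻L∣≤∣B∣ = *-cancelˡ-≤ t ⦃ >-nonZero 0<t ⦄ (begin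
        t * (4 * ∣ N⁻L ∣)
          ≡⟨ shuffle t ∣ N⁻L ∣ ⟩
        4 * t * ∣ N⁻L ∣
          ≤⟨ *-monoʳ-≤ (4 * t) (∣∣-⋃ N⁻L F (λ (z∈B , x , x∈L , zx) →
               cls x , (z∈B , x , (proj₁ (L⊆ x∈L) , zx) , refl) , x , x∈L , refl)) ⟩
        4 * t * sum (λ i → ∣ F i ∣)
          ≡⟨ sym (sum-*ˡ (4 * t) (λ i → ∣ F i ∣)) ⟩
        sum (λ i → 4 * t * ∣ F i ∣)
          ≤⟨ sum-mono (λ i → termwise i) ⟩
        sum (λ i → 𝟙 (hit? L i) * ω i * ∣ B ∣)
          ≡⟨ sum-*ʳ (λ i → 𝟙 (hit? L i) * ω i) ∣ B ∣ ⟩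
        sum (λ i → 𝟙 (hit? L i) * ω i) * ∣ B ∣
          ≤⟨ *-monoˡ-≤ ∣ B ∣ (weight≤t L (proj₁ ∘ L⊆) L-triangle-free) ⟩
        t * ∣ B ∣ ∎)
        where
        open ≤-Reasoning
        shuffle : ∀ x y → x * (4 * y) ≡ 4 * x * y
        shuffle = solve-∀
        shuffle′ : ∀ x y z → x * (y * z) ≡ z * (x * y)
        shuffle′ = solve-∀
        F : Fin n → DecSet n
        F i = sep (hits i) (λ _ → hit? L i)
        light : ∀ {i} → Hit L i → 4 * t * b i ≤ ω i * ∣ B ∣
        light (x , x∈L , refl) = ≮⇒≥ λ heavy → proj₂ (L⊆ x∈L) (proj₁ (L⊆ x∈L) , heavy)
        termwise : ∀ i → 4 * t * ∣ F i ∣ ≤ 𝟙 (hit? L i) * ω i * ∣ B ∣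
        termwise i = begin
          4 * t * ∣ F i ∣                        ≡⟨ cong (4 * t *_) (trans (sum-cong-≗ (λ z → 𝟙-× (z ∈? hits i) (hit? L i)))
                                                      (sum-*ʳ (λ z → 𝟙 (z ∈? hits i)) (𝟙 (hit? L i)))) ⟩
          4 * t * (b i * 𝟙 (hit? L i))           ≡⟨ shuffle′ (4 * t) (b i) (𝟙 (hit? L i)) ⟩
          𝟙 (hit? L i) * (4 * t * b i)           ≤⟨ 𝟙-*-mono (hit? L i) light ⟩
          𝟙 (hit? L i) * (ω i * ∣ B ∣)           ≡⟨ sym (*-assoc (𝟙 (hit? L i)) (ω i) ∣ B ∣) ⟩
          𝟙 (hit? L i) * ω i * ∣ B ∣             ∎

      ∣B∣≤4∣B∖N⁻L∣ : ∣ B ∣ ≤ 4 * ∣ B ∖ N⁻L ∣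
      ∣B∣≤4∣B∖N⁻L∣ = +-cancelˡ-≤ ∣ B ∣ _ _ (begin
        ∣ B ∣ + ∣ B ∣                              ≤⟨ +-monoʳ-≤ ∣ B ∣ (m≤m+n ∣ B ∣ (2 * ∣ B ∣)) ⟩
        4 * ∣ B ∣                                  ≤⟨ *-monoʳ-≤ 4 (∣∣-∖ B N⁻L) ⟩
        4 * (∣ N⁻L ∣ + ∣ B ∖ N⁻L ∣)                ≡⟨ *-distribˡ-+ 4 ∣ N⁻L ∣ ∣ B ∖ N⁻L ∣ ⟩
        4 * ∣ N⁻L ∣ + 4 * ∣ B ∖ N⁻L ∣              ≤⟨ +-monoˡ-≤ (4 * ∣ B ∖ N⁻L ∣) 4∣N⁻L∣≤∣B∣ ⟩
        ∣ B ∣ + 4 * ∣ B ∖ N⁻L ∣                    ∎)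
        where open ≤-Reasoning

      -- Every vertex of `B` outside `N⁻L` is dominated by all of `L`, so `L` is completely joined
      -- to a transitive set that also exceeds `t / 2`.
      contradiction : ⊥
      contradiction =
        let L′ , L′⊆ , L′-transitive , t<2L′ = half-of (B ∖ N⁻L) B proj₁ B⊆X ∣B∣<N B-large ∣B∣≤4∣B∖N⁻L∣
            dominates : Complete T L L′
            dominates x∈L z∈L′ = let z∈B , z∉N⁻L = L′⊆ z∈L′ in
              arc-flip T (λ { refl → A∩B≡∅ (proj₁ (L⊆ x∈L)) z∈B }) (λ zx → z∉N⁻L (z∈B , _ , x∈L , zx))
        in <-irrefl refl (<-≤-trans t<2L′ (two-halves ∣ L ∣ ∣ L′ ∣
             (complete-sum L L′ (A⊆X ∘ proj₁ ∘ L⊆) (B⊆X ∘ proj₁ ∘ L′⊆) L-transitive L′-transitive dominates) t<2L))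

    contradiction : ⊥
    contradiction =
      let L , L⊆ , L-transitive , t<2L = half-of A-light A proj₁ A⊆X ∣A∣<N A-large ∣A∣≤4∣A-light∣
      in Light.contradiction L L⊆ L-transitive t<2L

  contradiction : ⊥
  contradiction = ¬¬-partition λ cls part → Saturation.contradiction part
    (λ i → proj₁ (smaller-in-A (Class cls i) proj₁))
    (λ i → proj₁ (proj₂ (smaller-in-A (Class cls i) proj₁)))
    (λ i → proj₁ (proj₂ (proj₂ (smaller-in-A (Class cls i) proj₁))))
    (λ i → proj₂ (proj₂ (proj₂ (smaller-in-A (Class cls i) proj₁))))

-- Sparse blocks

disjoint-subsets : ∀ {n} m s (X : DecSet n) → m * s ≤ ∣ X ∣ →
  Σ (Fin m → DecSet n) λ V → (∀ i → V i ⊆ X) × (∀ i j → i ≢ j → Disjoint (V i) (V j)) × (∀ i → ∣ V i ∣ ≡ s)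
disjoint-subsets zero s X _ = (λ ()) , (λ ()) , (λ ()) , (λ ())
disjoint-subsets {n} (suc m) s X large =
  let V₀ , V₀⊆X , ∣V₀∣≡s = subset-of-size X s (≤-trans (m≤m+n s (m * s)) large)
      V , V⊆ , disjoint , size = disjoint-subsets m s (X ∖ V₀) (+-cancelˡ-≤ s _ _
        (≤-trans large (≤-trans (∣∣-∖ X V₀) (≤-reflexive (cong (_+ ∣ X ∖ V₀ ∣) ∣V₀∣≡s)))))
  in cons V₀ V , (λ { fzero → V₀⊆X ; (fsuc i) → proj₁ ∘ V⊆ i })
   , (λ { fzero fzero 0≢0 → ⊥-elim (0≢0 refl)
        ; fzero (fsuc j) _ → λ x∈V₀ x∈V → proj₂ (V⊆ j x∈V) x∈V₀
        ; (fsuc i) fzero _ → λ x∈V x∈V₀ → proj₂ (V⊆ i x∈V) x∈V₀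
        ; (fsuc i) (fsuc j) i≢j → disjoint i j (i≢j ∘ cong fsuc) })
   , (λ { fzero → ∣V₀∣≡s ; (fsuc i) → size i })
  where
  cons : DecSet n → (Fin m → DecSet n) → Fin (suc m) → DecSet n
  cons V₀ V fzero = V₀
  cons V₀ V (fsuc i) = V i

-- The summand `suc h` lets the first block outlast `h` bad sets of size `s`; the factor `K` pays
-- for the shrinking of the other blocks once the first vertex is placed.
embedding-constant : ℕ → ℕ → ℕ
embedding-constant K zero = 0
embedding-constant K (suc h) = suc h + K * embedding-constant K h

tail-tournament : ∀ {h} → Tournament (suc h) → Tournament h
tail-tournament H = Restrict H fsuc Fin.suc-injective

module _ {n : ℕ} (T : Tournament n) where

  N⟨_⟩ : Bool → DecSet n → Fin n → DecSet n
  N⟨ β ⟩ B a = sep B (λ b → arc T a b Bool.≟ β)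

  OneSided : ℕ → Bool → DecSet n → DecSet n → Set
  OneSided K β A B = ∀ {a} → a ∈ A → K * ∣ N⟨ β ⟩ B a ∣ < ∣ B ∣

  -- `A` is meant to precede `B`: arcs from `B` to `A` are the backward ones, and they are rare at
  -- every vertex of both sides.
  record Sparse (L : ℕ) (A B : DecSet n) : Set where
    field
      disjoint : Disjoint A B
      left     : ∀ {a} → a ∈ A → L * ∣ sep B (λ b → arc? T b a) ∣ ≤ ∣ B ∣
      right    : ∀ {b} → b ∈ B → L * ∣ sep A (λ a → arc? T b a) ∣ ≤ ∣ A ∣

  module _ (K s : ℕ) (0<K : 0 < K) (0<s : 0 < s) (X : DecSet n)
    (no-pair : ∀ β A B → A ⊆ X → B ⊆ X → Disjoint A B → s ≤ ∣ A ∣ → s ≤ ∣ B ∣ → OneSided K β A B → ⊥) where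

    -- The first vertex goes to some `v` that leaves a fraction `1 / K` of every later block with
    -- the required orientation. More than `s` vertices failing for the same `j` would form a
    -- forbidden one-sided pair with `V (fsuc j)`, so the `h` bad sets do not exhaust the first
    -- block.
    greedy-embedding : ∀ {h} (H : Tournament h) (V : Fin h → DecSet n) → (∀ i → V i ⊆ X) →
      (∀ i j → i ≢ j → Disjoint (V i) (V j)) → (∀ i → embedding-constant K h * s ≤ ∣ V i ∣) →
      Σ (Fin h → Fin n) λ f → (∀ i → f i ∈ V i) × (∀ i j → arc H i j ≡ arc T (f i) (f j))
    greedy-embedding {zero} H V _ _ _ = (λ ()) , (λ ()) , (λ ())
    greedy-embedding {suc h} H V V⊆X disjoint large = extend (Fin.any? λ v → (v ∈? V fzero) ×-dec Fin.all? (good? v))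
      where
      c : ℕ
      c = embedding-constant K h

      W : Fin n → Fin h → DecSet n
      W v j = N⟨ arc H fzero (fsuc j) ⟩ (V (fsuc j)) v

      Good : Fin n → Fin h → Set
      Good v j = ∣ V (fsuc j) ∣ ≤ K * ∣ W v j ∣

      good? : ∀ v j → Dec (Good v j)
      good? v j = ∣ V (fsuc j) ∣ ≤? K * ∣ W v j ∣

      Bad : Fin h → DecSet n
      Bad j = sep (V fzero) (λ v → ¬? (good? v j))

      s≤V : ∀ i → suc h * s ≤ ∣ V i ∣
      s≤V i = ≤-trans (*-monoˡ-≤ s (m≤m+n (suc h) (K * c))) (large i)

      ∣Bad∣≤s : ∀ j → ∣ Bad j ∣ ≤ s
      ∣Bad∣≤s j with ∣ Bad j ∣ ≤? s
      ... | yes le = le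
      ... | no ¬le = ⊥-elim (no-pair (arc H fzero (fsuc j)) (Bad j) (V (fsuc j)) (V⊆X fzero ∘ proj₁) (V⊆X (fsuc j))
              (λ x∈ x∈′ → disjoint fzero (fsuc j) Fin.0≢1+n (proj₁ x∈) x∈′)
              (<⇒≤ (≰⇒> ¬le)) (≤-trans (m≤m+n s (h * s)) (s≤V (fsuc j))) (≰⇒> ∘ proj₂))

      extend : Dec (∃ λ v → v ∈ V fzero × (∀ j → Good v j)) →
        Σ (Fin (suc h) → Fin n) λ f → (∀ i → f i ∈ V i) × (∀ i j → arc H i j ≡ arc T (f i) (f j))
      extend (no ∄) = ⊥-elim (<-irrefl refl (begin-strict
        h * s                      <⟨ m<n+m (h * s) 0<s ⟩
        suc h * s                  ≤⟨ s≤V fzero ⟩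
        ∣ V fzero ∣                ≤⟨ ∣∣-⋃ (V fzero) Bad (λ {v} v∈ → let j , bad = Fin.¬∀⟶∃¬ h (Good v) (good? v) (λ good → ∄ (v , v∈ , good)) in j , v∈ , bad) ⟩
        sum (λ j → ∣ Bad j ∣)      ≤⟨ sum-mono ∣Bad∣≤s ⟩
        sum {h} (λ _ → s)          ≡⟨ sum-const h s ⟩
        h * s                      ∎))
        where open ≤-Reasoning
      extend (yes (v , v∈ , good)) =
        let f , f∈ , f-arc = greedy-embedding (tail-tournament H) (W v) (λ j → V⊆X (fsuc j) ∘ proj₁)
              (λ i j i≢j x∈ x∈′ → disjoint (fsuc i) (fsuc j) (i≢j ∘ Fin.suc-injective) (proj₁ x∈) (proj₁ x∈′))
              (λ j → *-cancelˡ-≤ K ⦃ >-nonZero 0<K ⦄ (begin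
                K * (c * s)                ≡⟨ sym (*-assoc K c s) ⟩
                K * c * s                  ≤⟨ *-monoˡ-≤ s (m≤n+m (K * c) (suc h)) ⟩
                (suc h + K * c) * s        ≤⟨ large (fsuc j) ⟩
                ∣ V (fsuc j) ∣             ≤⟨ good j ⟩
                K * ∣ W v j ∣              ∎))
            v≢f : ∀ j → v ≢ f j
            v≢f j v≡f = disjoint fzero (fsuc j) Fin.0≢1+n v∈ (subst (_∈ V (fsuc j)) (sym v≡f) (proj₁ (f∈ j)))
        in cons v f , (λ { fzero → v∈ ; (fsuc j) → proj₁ (f∈ j) })
         , (λ { fzero fzero → trans (irrefl H fzero) (sym (irrefl T v))
              ; fzero (fsuc j) → sym (proj₂ (f∈ j))
              ; (fsuc i) fzero → trans (tournament H (fsuc i) fzero (Fin.0≢1+n ∘ sym))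
                                  (trans (cong not (sym (proj₂ (f∈ i)))) (sym (tournament T (f i) v (v≢f i ∘ sym))))
              ; (fsuc i) (fsuc j) → f-arc i j })
        where
        open ≤-Reasoning
        cons : Fin n → (Fin h → Fin n) → Fin (suc h) → Fin n
        cons v f fzero = v
        cons v f (fsuc i) = f i

  -- From one-sided pairs to sparse pairs

  module Trim (L : ℕ) (β : Bool) (A B : DecSet n) (0<∣A∣ : 0 < ∣ A ∣) (A∩B≡∅ : Disjoint A B)
    (one-sided : OneSided (2 * L) β A B) where

    R? : ∀ a b → Dec (arc T a b ≡ β)
    R? a b = arc T a b Bool.≟ β

    few? : ∀ b → Dec (L * ∣ sep A (λ a → R? a b) ∣ ≤ ∣ A ∣)
    few? b = L * ∣ sep A (λ a → R? a b) ∣ ≤? ∣ A ∣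

    B′ : DecSet n
    B′ = sep B few?

    -- Markov's inequality: at most `∣ A ∣ ∣ B ∣ / 2L` pairs have value `β`, and each discarded
    -- vertex of `B` accounts for more than `∣ A ∣ / L` of them.
    2∣B∖B′∣≤∣B∣ : 2 * ∣ B ∖ B′ ∣ ≤ ∣ B ∣
    2∣B∖B′∣≤∣B∣ = *-cancelˡ-≤ ∣ A ∣ ⦃ >-nonZero 0<∣A∣ ⦄ (begin
      ∣ A ∣ * (2 * ∣ B ∖ B′ ∣)
        ≡⟨ shuffle ∣ A ∣ ∣ B ∖ B′ ∣ ⟩
      2 * (∣ B ∖ B′ ∣ * ∣ A ∣)
        ≡⟨ cong (2 *_) (sym (sum-*ʳ (λ b → 𝟙 (b ∈? B ∖ B′)) ∣ A ∣)) ⟩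
      2 * sum (λ b → 𝟙 (b ∈? B ∖ B′) * ∣ A ∣)
        ≤⟨ *-monoʳ-≤ 2 (sum-mono λ b → many b) ⟩
      2 * sum (λ b → L * (𝟙 (b ∈? B) * ∣ sep A (λ a → R? a b) ∣))
        ≡⟨ cong (2 *_) (sum-*ˡ L (λ b → 𝟙 (b ∈? B) * ∣ sep A (λ a → R? a b) ∣)) ⟩
      2 * (L * sum (λ b → 𝟙 (b ∈? B) * ∣ sep A (λ a → R? a b) ∣))
        ≡⟨ sym (*-assoc 2 L _) ⟩
      2 * L * sum (λ b → 𝟙 (b ∈? B) * ∣ sep A (λ a → R? a b) ∣)
        ≡⟨ cong (2 * L *_) (sym (double-count A B R?)) ⟩
      2 * L * sum (λ a → 𝟙 (a ∈? A) * ∣ N⟨ β ⟩ B a ∣)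
        ≡⟨ sym (sum-*ˡ (2 * L) (λ a → 𝟙 (a ∈? A) * ∣ N⟨ β ⟩ B a ∣)) ⟩
      sum (λ a → 2 * L * (𝟙 (a ∈? A) * ∣ N⟨ β ⟩ B a ∣))
        ≡⟨ sum-cong-≗ (λ a → shuffle′ (2 * L) (𝟙 (a ∈? A)) ∣ N⟨ β ⟩ B a ∣) ⟩
      sum (λ a → 𝟙 (a ∈? A) * (2 * L * ∣ N⟨ β ⟩ B a ∣))
        ≤⟨ sum-mono (λ a → 𝟙-*-mono (a ∈? A) (λ a∈A → <⇒≤ (one-sided a∈A))) ⟩
      sum (λ a → 𝟙 (a ∈? A) * ∣ B ∣)
        ≡⟨ sum-*ʳ (λ a → 𝟙 (a ∈? A)) ∣ B ∣ ⟩
      ∣ A ∣ * ∣ B ∣ ∎)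
      where
      open ≤-Reasoning
      shuffle : ∀ x y → x * (2 * y) ≡ 2 * (y * x)
      shuffle = solve-∀
      shuffle′ : ∀ x y z → x * (y * z) ≡ y * (x * z)
      shuffle′ = solve-∀
      many : ∀ b → 𝟙 (b ∈? B ∖ B′) * ∣ A ∣ ≤ L * (𝟙 (b ∈? B) * ∣ sep A (λ a → R? a b) ∣)
      many b = bound (b ∈? B ∖ B′)
        where
        bound : ∀ d → 𝟙 d * ∣ A ∣ ≤ L * (𝟙 (b ∈? B) * ∣ sep A (λ a → R? a b) ∣)
        bound (no _) = z≤n
        bound (yes (b∈B , b∉B′)) = begin
          1 * ∣ A ∣                                               ≡⟨ *-identityˡ ∣ A ∣ ⟩
          ∣ A ∣                                                   ≤⟨ <⇒≤ (≰⇒> λ le → b∉B′ (b∈B , le)) ⟩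
          L * ∣ sep A (λ a → R? a b) ∣                            ≡⟨ cong (L *_) (sym (*-identityˡ ∣ sep A (λ a → R? a b) ∣)) ⟩
          L * (1 * ∣ sep A (λ a → R? a b) ∣)                      ≡⟨ cong (λ k → L * (k * ∣ sep A (λ a → R? a b) ∣)) (sym (𝟙-yes (b ∈? B) b∈B)) ⟩
          L * (𝟙 (b ∈? B) * ∣ sep A (λ a → R? a b) ∣)             ∎

    ∣B∣≤2∣B′∣ : ∣ B ∣ ≤ 2 * ∣ B′ ∣
    ∣B∣≤2∣B′∣ = +-cancelˡ-≤ ∣ B ∣ _ _ (begin
      ∣ B ∣ + ∣ B ∣                    ≡⟨ cong (∣ B ∣ +_) (sym (+-identityʳ ∣ B ∣)) ⟩
      2 * ∣ B ∣                        ≤⟨ *-monoʳ-≤ 2 (∣∣-∖ B B′) ⟩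
      2 * (∣ B′ ∣ + ∣ B ∖ B′ ∣)        ≡⟨ trans (*-distribˡ-+ 2 ∣ B′ ∣ ∣ B ∖ B′ ∣) (+-comm (2 * ∣ B′ ∣) (2 * ∣ B ∖ B′ ∣)) ⟩
      2 * ∣ B ∖ B′ ∣ + 2 * ∣ B′ ∣      ≤⟨ +-monoˡ-≤ (2 * ∣ B′ ∣) 2∣B∖B′∣≤∣B∣ ⟩
      ∣ B ∣ + 2 * ∣ B′ ∣               ∎)
      where open ≤-Reasoning

    -- `B′` keeps at least half of `B`, and the factor 2 in `OneSided (2 * L)` pays for the loss.
    few-in-B′ : ∀ {a} → a ∈ A → L * ∣ N⟨ β ⟩ B′ a ∣ ≤ ∣ B′ ∣
    few-in-B′ {a} a∈A = *-cancelˡ-≤ 2 (begin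
      2 * (L * ∣ N⟨ β ⟩ B′ a ∣)      ≡⟨ sym (*-assoc 2 L ∣ N⟨ β ⟩ B′ a ∣) ⟩
      2 * L * ∣ N⟨ β ⟩ B′ a ∣        ≤⟨ *-monoʳ-≤ (2 * L) (∣∣-mono (N⟨ β ⟩ B′ a) (N⟨ β ⟩ B a) (λ ((b∈B , _) , ab) → b∈B , ab)) ⟩
      2 * L * ∣ N⟨ β ⟩ B a ∣         ≤⟨ <⇒≤ (one-sided a∈A) ⟩
      ∣ B ∣                          ≤⟨ ∣B∣≤2∣B′∣ ⟩
      2 * ∣ B′ ∣                     ∎)
      where open ≤-Reasoning

  not-arc : ∀ {a b} → Arc T b a → arc T a b ≡ false
  not-arc {a} {b} ba with arc T a b in e
  ... | true = ⊥-elim (arc-asym T ba e)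
  ... | false = refl

  -- `β` is the rare value of `arc T a b`: if arcs from `A` to `B` are rare, then `B′` precedes `A`;
  -- otherwise `A` precedes `B′`.
  trim : ∀ L β A B → 0 < ∣ A ∣ → Disjoint A B → OneSided (2 * L) β A B →
    Σ (DecSet n) λ B′ → B′ ⊆ B × ∣ B ∣ ≤ 2 * ∣ B′ ∣ × (Sparse L A B′ ⊎ Sparse L B′ A)
  trim L true A B 0<∣A∣ A∩B≡∅ one-sided = B′ , proj₁ , ∣B∣≤2∣B′∣ , inj₂ (record
    { disjoint = λ x∈B′ x∈A → A∩B≡∅ x∈A (proj₁ x∈B′) ; left = proj₂ ; right = few-in-B′ })
    where open Trim L true A B 0<∣A∣ A∩B≡∅ one-sided
  trim L false A B 0<∣A∣ A∩B≡∅ one-sided = B′ , proj₁ , ∣B∣≤2∣B′∣ , inj₁ (record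
    { disjoint = λ x∈A x∈B′ → A∩B≡∅ x∈A (proj₁ x∈B′)
    ; left = λ {a} a∈A → ≤-trans (*-monoʳ-≤ L (∣∣-mono (sep B′ (λ b → arc? T b a)) (N⟨ false ⟩ B′ a) λ (b∈ , ba) → b∈ , not-arc ba)) (few-in-B′ a∈A)
    ; right = λ {b} b∈B′ → ≤-trans (*-monoʳ-≤ L (∣∣-mono (sep A (λ a → arc? T b a)) (sep A (λ a → R? a b)) λ (a∈ , ba) → a∈ , not-arc ba)) (proj₂ b∈B′)
    })
    where open Trim L false A B 0<∣A∣ A∩B≡∅ one-sided

pair-base : ℕ → ℕ → ℕ
pair-base h L = suc (h * embedding-constant (2 * L) h)

-- Of the factor 4, one 2 pays for rounding in the quotient of `∣ X ∣` by `pair-base`, the other for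
-- trimming.
pair-constant : ℕ → ℕ → ℕ
pair-constant h L = 4 * pair-base h L

-- One sparse pair gives the first block, and the other blocks are found inside its second set. As
-- these may be smaller by the factor `block-constant h L m`, the pair must be sparser than `L` by
-- that factor.
block-constant : ℕ → ℕ → ℕ → ℕ
block-constant h L zero = 1
block-constant h L (suc m) = pair-constant h (L * block-constant h L m) * block-constant h L m

0<block-constant : ∀ h L m → 0 < block-constant h L m
0<block-constant h L zero = s≤s z≤n
0<block-constant h L (suc m) = *-mono-≤ {1} {pair-constant h (L * block-constant h L m)} {1} (s≤s z≤n) (0<block-constant h L m)

module _ {n : ℕ} (T : Tournament n) {h : ℕ} (H : Tournament h) (H-free : ¬ Contains T H) where

  -- Without one-sided pairs the greedy embedding would find a copy of `H`; a one-sided pair is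
  -- trimmed to a sparse one.
  ¬¬-sparse-pair : ∀ L → 0 < L → ∀ X → pair-constant h L ≤ ∣ X ∣ →
    (∀ A B → A ⊆ X → B ⊆ X → ∣ X ∣ ≤ pair-constant h L * ∣ A ∣ → ∣ X ∣ ≤ pair-constant h L * ∣ B ∣ → Sparse T L A B → ⊥) → ⊥
  ¬¬-sparse-pair L 0<L X large k =
    let V , V⊆X , disjoint , size = disjoint-subsets h (c * s) X room
        f , f∈ , f-arc = greedy-embedding T (2 * L) s (≤-trans 0<L (m≤m+n L (L + 0))) 0<s X no-pair H V V⊆X disjoint
                           (λ i → ≤-reflexive (sym (size i)))
    in H-free (f , (λ {i} {j} fi≡fj → decidable-stable (i Fin.≟ j) λ i≢j →
         disjoint i j i≢j (f∈ i) (subst (_∈ V j) (sym fi≡fj) (f∈ j))) , f-arc)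
    where
    c base s : ℕ
    c = embedding-constant (2 * L) h
    base = pair-base h L
    s = ∣ X ∣ / base
    base≤∣X∣ : base ≤ ∣ X ∣
    base≤∣X∣ = ≤-trans (m≤m+n base (3 * base)) large
    0<s : 0 < s
    0<s = m≥n⇒m/n>0 base≤∣X∣
    room : h * (c * s) ≤ ∣ X ∣
    room = begin
      h * (c * s)      ≡⟨ sym (*-assoc h c s) ⟩
      h * c * s        ≤⟨ *-monoˡ-≤ s (n≤1+n (h * c)) ⟩
      base * s         ≡⟨ *-comm base s ⟩
      s * base         ≤⟨ m/n*n≤m ∣ X ∣ base ⟩
      ∣ X ∣            ∎
      where open ≤-Reasoning
    ∣X∣≤2bs : ∣ X ∣ ≤ 2 * (base * s)
    ∣X∣≤2bs = begin
      ∣ X ∣                          ≡⟨ m≡m%n+[m/n]*n ∣ X ∣ base ⟩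
      ∣ X ∣ % base + s * base        ≤⟨ +-monoˡ-≤ (s * base) (<⇒≤ (m%n<n ∣ X ∣ base)) ⟩
      base + s * base                ≤⟨ +-monoˡ-≤ (s * base) (≤-trans (≤-reflexive (sym (*-identityˡ base))) (*-monoˡ-≤ base 0<s)) ⟩
      s * base + s * base            ≡⟨ shuffle s base ⟩
      2 * (base * s)                 ∎
      where
      open ≤-Reasoning
      shuffle : ∀ x y → x * y + x * y ≡ 2 * (y * x)
      shuffle = solve-∀
    scaled : ∀ {y} → s ≤ 2 * y → ∣ X ∣ ≤ pair-constant h L * y
    scaled {y} s≤2y = begin
      ∣ X ∣                      ≤⟨ ∣X∣≤2bs ⟩
      2 * (base * s)             ≤⟨ *-monoʳ-≤ 2 (*-monoʳ-≤ base s≤2y) ⟩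
      2 * (base * (2 * y))       ≡⟨ shuffle base y ⟩
      4 * base * y               ∎
      where
      open ≤-Reasoning
      shuffle : ∀ x y → 2 * (x * (2 * y)) ≡ 4 * x * y
      shuffle = solve-∀
    no-pair : ∀ β A B → A ⊆ X → B ⊆ X → Disjoint A B → s ≤ ∣ A ∣ → s ≤ ∣ B ∣ → OneSided T (2 * L) β A B → ⊥
    no-pair β A B A⊆X B⊆X A∩B≡∅ s≤A s≤B one-sided =
      let B′ , B′⊆B , B≤2B′ , sparse = trim T L β A B (≤-trans 0<s s≤A) A∩B≡∅ one-sided
          A-size = scaled (≤-trans s≤A (m≤m+n ∣ A ∣ (∣ A ∣ + 0)))
          B-size = scaled (≤-trans s≤B B≤2B′)
      in [ k A B′ A⊆X (B⊆X ∘ B′⊆B) A-size B-size , k B′ A (B⊆X ∘ B′⊆B) A⊆X B-size A-size ] sparse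

  sparse-restrict : ∀ L C A B B′ → 0 < C → B′ ⊆ B → ∣ B ∣ ≤ C * ∣ B′ ∣ → Sparse T (L * C) A B → Sparse T L A B′
  sparse-restrict L C A B B′ 0<C B′⊆B B≤CB′ sparse = record
    { disjoint = λ x∈A x∈B′ → Sparse.disjoint sparse x∈A (B′⊆B x∈B′)
    ; left = λ {a} a∈A → *-cancelˡ-≤ C ⦃ >-nonZero 0<C ⦄ (begin
        C * (L * ∣ sep B′ (λ b → arc? T b a) ∣)    ≡⟨ shuffle C L ∣ sep B′ (λ b → arc? T b a) ∣ ⟩
        L * C * ∣ sep B′ (λ b → arc? T b a) ∣      ≤⟨ *-monoʳ-≤ (L * C) (∣∣-mono (sep B′ (λ b → arc? T b a)) (sep B (λ b → arc? T b a)) (λ (b∈ , ba) → B′⊆B b∈ , ba)) ⟩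
        L * C * ∣ sep B (λ b → arc? T b a) ∣       ≤⟨ Sparse.left sparse a∈A ⟩
        ∣ B ∣                                      ≤⟨ B≤CB′ ⟩
        C * ∣ B′ ∣                                 ∎)
    ; right = λ {b} b∈B′ → begin
        L * ∣ sep A (λ a → arc? T b a) ∣           ≤⟨ *-monoˡ-≤ ∣ sep A (λ a → arc? T b a) ∣ (≤-trans (≤-reflexive (sym (*-identityʳ L))) (*-monoʳ-≤ L 0<C)) ⟩
        L * C * ∣ sep A (λ a → arc? T b a) ∣       ≤⟨ Sparse.right sparse (B′⊆B b∈B′) ⟩
        ∣ A ∣                                      ∎
    }
    where
    open ≤-Reasoning
    shuffle : ∀ x y z → x * (y * z) ≡ y * x * z
    shuffle = solve-∀

  record Blocks (L C : ℕ) (X : DecSet n) {m : ℕ} (D : Fin m → DecSet n) : Set where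
    field
      inside : ∀ i → D i ⊆ X
      large  : ∀ i → ∣ X ∣ ≤ C * ∣ D i ∣
      sparse : ∀ i j → toℕ i < toℕ j → Sparse T L (D i) (D j)

  ¬¬-blocks : ∀ L → 0 < L → ∀ m X → block-constant h L m ≤ ∣ X ∣ →
    (∀ D → Blocks L (block-constant h L m) X {m} D → ⊥) → ⊥
  ¬¬-blocks L 0<L zero X _ k = k (λ ()) (record { inside = λ () ; large = λ () ; sparse = λ () })
  ¬¬-blocks L 0<L (suc m) X large k =
    ¬¬-sparse-pair (L * C) (*-mono-≤ 0<L 0<C) X (≤-trans (≤-trans (≤-reflexive (sym (*-identityʳ P))) (*-monoʳ-≤ P 0<C)) large)
      λ A B A⊆X B⊆X X≤PA X≤PB A-B-sparse →
        ¬¬-blocks L 0<L m B (*-cancelˡ-≤ P (≤-trans large X≤PB)) λ D blocks →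
          let open Blocks blocks renaming (inside to inside′; large to large′; sparse to sparse′) in
          k (cons A D) (record
            { inside = λ { fzero → A⊆X ; (fsuc i) → B⊆X ∘ inside′ i }
            ; large = λ { fzero → ≤-trans X≤PA (*-monoˡ-≤ ∣ A ∣ (≤-trans (≤-reflexive (sym (*-identityʳ P))) (*-monoʳ-≤ P 0<C)))
                        ; (fsuc i) → ≤-trans X≤PB (≤-trans (*-monoʳ-≤ P (large′ i)) (≤-reflexive (sym (*-assoc P C ∣ D i ∣)))) }
            ; sparse = λ { fzero fzero ()
                         ; fzero (fsuc j) _ → sparse-restrict L C A B (D j) 0<C (inside′ j) (large′ j) A-B-sparse
                         ; (fsuc i) fzero ()
                         ; (fsuc i) (fsuc j) (s≤s i<j) → sparse′ i j i<j }
            })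
    where
    C P : ℕ
    C = block-constant h L m
    P = pair-constant h (L * C)
    0<C : 0 < C
    0<C = 0<block-constant h L m
    cons : DecSet n → (Fin m → DecSet n) → Fin (suc m) → DecSet n
    cons A D fzero = A
    cons A D (fsuc i) = D i

-- Embedding a flotilla into blocks

reverse : ∀ {n} → Tournament n → Tournament n
reverse T = record
  { arc = λ u v → arc T v u
  ; irrefl = irrefl T
  ; tournament = λ u v u≢v → tournament T v u (u≢v ∘ sym)
  }

reverse-transitive : ∀ {n} (T : Tournament n) S → TransitiveOn (reverse T) S → TransitiveOn T S
reverse-transitive T S tr x∈ y∈ w∈ xy yw = tr w∈ y∈ x∈ yw xy

reverse-critical : ∀ {n} {T : Tournament n} {X q t} → Critical T X q t → Critical (reverse T) X q t
reverse-critical {T = T} crit = record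
  { bounded = λ S S⊆X tr → bounded S S⊆X (reverse-transitive T S tr)
  ; smaller = λ Y Y⊆X Y<X → let S , S⊆Y , tr , Y≤ = smaller Y Y⊆X Y<X in S , S⊆Y , reverse-transitive (reverse T) S tr , Y≤
  ; t^q<∣X∣ = t^q<∣X∣
  ; 2^q≤∣X∣ = 2^q≤∣X∣
  }
  where open Critical crit

-- At most `4 * h` entries, each excluding at most `1 / L` of a block, leave at least half of it
-- when `L` is `8 * suc h`. In `C-small`, 128 is this factor 2 times the 64 of `BoatFree`.
module Embedding {n h : ℕ} (T : Tournament n) (H : Tournament h) (H-free : ¬ Contains T H)
  (θ : Permutation′ h)
  (components : ∀ x → Σ (Fin h) λ a → Σ (Fin h) λ b → Σ (Fin h) λ c → Σ (Fin h) λ d →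
                  ComponentIs H θ x a b c d × (LeftBoat H θ a b c d ⊎ RightBoat H θ a b c d))
  {X : DecSet n} {q′ t C : ℕ} (crit : Critical T X (2 + q′) t) (C-small : 128 * C ≤ 2 ^ (2 + q′))
  (D : Fin h → DecSet n) (blocks : Blocks T H H-free (8 * suc h) C X D) where

  open Blocks blocks

  q L : ℕ
  q = 2 + q′
  L = 8 * suc h

  θ-injective : ∀ {p p′} → θ ⟨$⟩ʳ p ≡ θ ⟨$⟩ʳ p′ → p ≡ p′
  θ-injective e = trans (sym (inverseˡ θ)) (trans (cong (θ ⟨$⟩ˡ_) e) (inverseˡ θ))

  HArc : Fin h → Fin h → Set
  HArc p p′ = Arc H (θ ⟨$⟩ʳ p) (θ ⟨$⟩ʳ p′)

  forward : ∀ {p p′} → toℕ p < toℕ p′ → ¬ BEdge H θ p p′ → HArc p p′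
  forward p<p′ ¬edge = arc-flip H (λ e → <-irrefl (cong toℕ (θ-injective (sym e))) p<p′) (λ back → ¬edge (inj₁ (p<p′ , back)))

  backward : ∀ {p p′} → toℕ p < toℕ p′ → BEdge H θ p p′ → HArc p′ p
  backward p<p′ (inj₁ (_ , back)) = back
  backward p<p′ (inj₂ (p′<p , _)) = ⊥-elim (<-asym p<p′ p′<p)

  BEdge-sym : ∀ {p p′} → BEdge H θ p p′ → BEdge H θ p′ p
  BEdge-sym (inj₁ x) = inj₂ x
  BEdge-sym (inj₂ x) = inj₁ x

  -- A partial embedding is a list of entries (position of θ, vertex of T).
  Entry : Set
  Entry = Fin h × Fin n

  -- Records actual arcs in both tournaments, so that entries at different positions automatically
  -- have different vertices.
  SameArc : Entry → Entry → Set
  SameArc (p , v) (p′ , v′) = (HArc p p′ × Arc T v v′) ⊎ (HArc p′ p × Arc T v′ v)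

  SameArc-sym : ∀ {e e′} → SameArc e e′ → SameArc e′ e
  SameArc-sym (inj₁ x) = inj₂ x
  SameArc-sym (inj₂ x) = inj₁ x

  Placed : Fin h → List Entry → Set
  Placed p l = ∃ λ v → (p , v) ∈ₗ l

  placed? : ∀ p l → Dec (Placed p l)
  placed? p [] = no λ { (_ , ()) }
  placed? p ((p′ , v) ∷ l) with p Fin.≟ p′ | placed? p l
  ... | yes refl | _ = yes (v , here refl)
  ... | no _ | yes (w , w∈) = yes (w , there w∈)
  ... | no p≢p′ | no ¬placed = no λ { (_ , here refl) → p≢p′ refl ; (w , there w∈) → ¬placed (w , w∈) }

  Forward : Entry → Fin h → Fin n → Set
  Forward (p , v) p′ y = (toℕ p < toℕ p′ × Arc T v y) ⊎ (toℕ p′ < toℕ p × Arc T y v)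

  forward? : ∀ e p y → Dec (Forward e p y)
  forward? (p , v) p′ y = ((toℕ p <? toℕ p′) ×-dec arc? T v y) ⊎-dec ((toℕ p′ <? toℕ p) ×-dec arc? T y v)

  Candidates : List Entry → Fin h → DecSet n
  Candidates [] p = D p
  Candidates (e ∷ l) p = sep (Candidates l p) (forward? e p)

  candidates⊆D : ∀ l {p} → Candidates l p ⊆ D p
  candidates⊆D [] x∈ = x∈
  candidates⊆D (e ∷ l) (x∈ , _) = candidates⊆D l x∈

  candidate-forward : ∀ l {p y e} → y ∈ Candidates l p → e ∈ₗ l → Forward e p y
  candidate-forward (e ∷ l) (_ , fwd) (here refl) = fwd
  candidate-forward (e ∷ l) (y∈ , _) (there e∈) = candidate-forward l y∈ e∈

  Excluded : Entry → Fin h → DecSet n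
  Excluded e p = sep (D p) (λ y → ¬? (forward? e p y))

  FewExcluded : Entry → Fin h → Set
  FewExcluded e p = L * ∣ Excluded e p ∣ ≤ ∣ D p ∣

  candidates-large : ∀ l p → (∀ {e} → e ∈ₗ l → FewExcluded e p) →
    L * ∣ D p ∣ ≤ L * ∣ Candidates l p ∣ + length l * ∣ D p ∣
  candidates-large [] p _ = m≤m+n _ _
  candidates-large (e ∷ l) p few = begin
    L * ∣ D p ∣
      ≤⟨ candidates-large l p (few ∘ there) ⟩
    L * ∣ Candidates l p ∣ + length l * ∣ D p ∣
      ≤⟨ +-monoˡ-≤ (length l * ∣ D p ∣) (*-monoʳ-≤ L (∣∣-cover (Candidates l p) (Candidates (e ∷ l) p) (Excluded e p) split)) ⟩
    L * (∣ Candidates (e ∷ l) p ∣ + ∣ Excluded e p ∣) + length l * ∣ D p ∣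
      ≡⟨ trans (cong (_+ length l * ∣ D p ∣) (*-distribˡ-+ L ∣ Candidates (e ∷ l) p ∣ ∣ Excluded e p ∣))
               (+-assoc (L * ∣ Candidates (e ∷ l) p ∣) (L * ∣ Excluded e p ∣) (length l * ∣ D p ∣)) ⟩
    L * ∣ Candidates (e ∷ l) p ∣ + (L * ∣ Excluded e p ∣ + length l * ∣ D p ∣)
      ≤⟨ +-monoʳ-≤ (L * ∣ Candidates (e ∷ l) p ∣) (+-monoˡ-≤ (length l * ∣ D p ∣) (few (here refl))) ⟩
    L * ∣ Candidates (e ∷ l) p ∣ + (∣ D p ∣ + length l * ∣ D p ∣) ∎
    where
    open ≤-Reasoning
    split : ∀ {y} → y ∈ Candidates l p → y ∈ Candidates (e ∷ l) p ⊎ y ∈ Excluded e p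
    split {y} y∈ with forward? e p y
    ... | yes fwd = inj₁ (y∈ , fwd)
    ... | no ¬fwd = inj₂ (candidates⊆D l y∈ , ¬fwd)

  -- `closed` makes the placed positions a union of components of the backward graph, so their arcs
  -- with all other positions are forward; `few` keeps most of each unplaced block available.
  record PartialEmbedding (l : List Entry) : Set where
    field
      same-arcs : ∀ {e e′} → e ∈ₗ l → e′ ∈ₗ l → proj₁ e ≢ proj₁ e′ → SameArc e e′
      closed    : ∀ {p p′} → Placed p l → BEdge H θ p p′ → Placed p′ l
      few       : ∀ {e p} → e ∈ₗ l → ¬ Placed p l → FewExcluded e p

  add-same-arcs : ∀ e l → (∀ {e e′} → e ∈ₗ l → e′ ∈ₗ l → proj₁ e ≢ proj₁ e′ → SameArc e e′) →
    (∀ {e′} → e′ ∈ₗ l → SameArc e e′) → ∀ {e₁ e₂} → e₁ ∈ₗ e ∷ l → e₂ ∈ₗ e ∷ l → proj₁ e₁ ≢ proj₁ e₂ → SameArc e₁ e₂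
  add-same-arcs e l old new (here refl) (here refl) p≢p = ⊥-elim (p≢p refl)
  add-same-arcs e l old new (here refl) (there e₂∈) _ = new e₂∈
  add-same-arcs e l old new (there e₁∈) (here refl) _ = SameArc-sym (new e₁∈)
  add-same-arcs e l old new (there e₁∈) (there e₂∈) p≢ = old e₁∈ e₂∈ p≢

  closed* : ∀ {l} → PartialEmbedding l → ∀ {p p′} → Placed p l → Reach H θ p p′ → Placed p′ l
  closed* partial placed ε = placed
  closed* partial placed (edge ◅ path) = closed* partial (PartialEmbedding.closed partial placed edge) path

  reach-sym : ∀ {p p′} → Reach H θ p p′ → Reach H θ p′ p
  reach-sym ε = ε
  reach-sym (edge ◅ path) = reach-sym path ◅◅ (BEdge-sym edge ◅ ε)

  -- Adding one boat to a partial embedding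

  module Step {l : List Entry} (partial : PartialEmbedding l) {x a b c d : Fin h} (¬placed : ¬ Placed x l)
    (component : ComponentIs H θ x a b c d) (a<b : toℕ a < toℕ b) (b<c : toℕ b < toℕ c) (c<d : toℕ c < toℕ d)
    (edges : BoatEdges H θ a b c d) where
    open PartialEmbedding partial

    InBoat : Fin h → Set
    InBoat p = p ≡ a ⊎ p ≡ b ⊎ p ≡ c ⊎ p ≡ d

    boat-unplaced : ∀ {p} → InBoat p → ¬ Placed p l
    boat-unplaced {p} p∈ placed = ¬placed (closed* partial placed (reach-sym (Equivalence.from (component p) p∈)))

    outside : ∀ {p p′} → InBoat p → Placed p′ l → p ≢ p′ × ¬ BEdge H θ p p′
    outside p∈ placed = (λ { refl → boat-unplaced p∈ placed })
                      , (λ edge → boat-unplaced p∈ (closed placed (BEdge-sym edge)))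

    -- The three consecutive positions of a boat share one block β: no position outside the boat separates them.
    record Block (p β : Fin h) : Set where
      field
        below : ∀ {p′} → ¬ InBoat p′ → toℕ p < toℕ p′ → toℕ β < toℕ p′
        above : ∀ {p′} → ¬ InBoat p′ → toℕ p′ < toℕ p → toℕ p′ < toℕ β

    self-block : ∀ {p} → Block p p
    self-block = record { below = λ _ → id ; above = λ _ → id }

    next-block : ∀ {p p′ β} → InBoat p → toℕ p′ ≡ suc (toℕ p) → Block p β → Block p′ β
    next-block {p} {p′} {β} p∈ p′≡1+p block = record
      { below = λ r∉ p′<r → Block.below block r∉ (<-trans (≤-reflexive (sym p′≡1+p)) p′<r)
      ; above = λ {r} r∉ r<p′ → Block.above block r∉
          (≤∧≢⇒< (s≤s⁻¹ (≤-trans r<p′ (≤-reflexive p′≡1+p))) (λ e → r∉ (subst InBoat (sym (Fin.toℕ-injective e)) p∈)))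
      }

    record NewEntry (p : Fin h) (v : Fin n) : Set where
      field
        {β}        : Fin h
        p∈boat     : InBoat p
        block      : Block p β
        v∈         : v ∈ Candidates l β

    -- `e` lies in another component, so its arc with `p` in `H` is forward. The vertex `v` is
    -- forward to `e` as seen from `β`, and no placed position separates `p` from `β`.
    new-same-arc : ∀ {p v} → NewEntry p v → ∀ {e} → e ∈ₗ l → SameArc (p , v) e
    new-same-arc {p} {v} new {p′ , v′} e∈ = go (Fin.<-cmp p p′) (candidate-forward l v∈ e∈)
      where
      open NewEntry new
      p≢p′ = proj₁ (outside p∈boat (v′ , e∈))
      ¬edge = proj₂ (outside p∈boat (v′ , e∈))
      p′∉boat : ¬ InBoat p′
      p′∉boat p′∈ = boat-unplaced p′∈ (v′ , e∈)
      go : _ → Forward (p′ , v′) β v → SameArc (p , v) (p′ , v′)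
      go (tri≈ _ p≡p′ _) _ = ⊥-elim (p≢p′ p≡p′)
      go (tri< p<p′ _ _) (inj₁ (p′<β , _)) = ⊥-elim (<-asym p′<β (Block.below block p′∉boat p<p′))
      go (tri< p<p′ _ _) (inj₂ (_ , vv′)) = inj₁ (forward p<p′ ¬edge , vv′)
      go (tri> _ _ p′<p) (inj₁ (_ , v′v)) = inj₂ (forward p′<p (¬edge ∘ BEdge-sym) , v′v)
      go (tri> _ _ p′<p) (inj₂ (β<p′ , _)) = ⊥-elim (<-asym β<p′ (Block.above block p′∉boat p′<p))

    -- `v` lies in block `β`, which is on the same side of `r` as `p`, so the sparsity between `D β`
    -- and `D r` bounds the exclusions.
    new-few : ∀ {p v} → NewEntry p v → ∀ {r} → ¬ InBoat r → FewExcluded (p , v) r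
    new-few {p} {v} new {r} r∉boat = go (Fin.<-cmp p r)
      where
      open NewEntry new
      v∈D : v ∈ D β
      v∈D = candidates⊆D l v∈
      go : _ → FewExcluded (p , v) r
      go (tri≈ _ refl _) = ⊥-elim (r∉boat p∈boat)
      go (tri< p<r _ _) = ≤-trans (*-monoʳ-≤ L (∣∣-mono (Excluded (p , v) r) (sep (D r) (λ y → arc? T y v))
          (λ (y∈ , ¬fwd) → y∈ , arc-flip T (λ { refl → Sparse.disjoint β-r v∈D y∈ }) (λ vy → ¬fwd (inj₁ (p<r , vy))))))
          (Sparse.left β-r v∈D)
        where
        β-r : Sparse T L (D β) (D r)
        β-r = sparse β r (Block.below block r∉boat p<r)
      go (tri> _ _ r<p) = ≤-trans (*-monoʳ-≤ L (∣∣-mono (Excluded (p , v) r) (sep (D r) (λ y → arc? T v y))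
          (λ (y∈ , ¬fwd) → y∈ , arc-flip T (λ { refl → Sparse.disjoint r-β y∈ v∈D }) (λ yv → ¬fwd (inj₂ (r<p , yv))))))
          (Sparse.right r-β v∈D)
        where
        r-β : Sparse T L (D r) (D β)
        r-β = sparse r β (Block.above block r∉boat r<p)

    boat-placed : ∀ {vᵃ vᵇ vᶜ vᵈ p} → InBoat p → Placed p ((a , vᵃ) ∷ (b , vᵇ) ∷ (c , vᶜ) ∷ (d , vᵈ) ∷ l)
    boat-placed (inj₁ refl) = _ , here refl
    boat-placed (inj₂ (inj₁ refl)) = _ , there (here refl)
    boat-placed (inj₂ (inj₂ (inj₁ refl))) = _ , there (there (here refl))
    boat-placed (inj₂ (inj₂ (inj₂ refl))) = _ , there (there (there (here refl)))

    old-placed : ∀ {vᵃ vᵇ vᶜ vᵈ p} → Placed p l → Placed p ((a , vᵃ) ∷ (b , vᵇ) ∷ (c , vᶜ) ∷ (d , vᵈ) ∷ l)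
    old-placed (v , e∈) = v , there (there (there (there e∈)))

    add-boat : ∀ {vᵃ vᵇ vᶜ vᵈ} → NewEntry a vᵃ → NewEntry b vᵇ → NewEntry c vᶜ → NewEntry d vᵈ →
      Arc T vᵃ vᵇ → Arc T vᵇ vᶜ → Arc T vᶜ vᵈ → Arc T vᶜ vᵃ → Arc T vᵈ vᵃ → Arc T vᵈ vᵇ →
      PartialEmbedding ((a , vᵃ) ∷ (b , vᵇ) ∷ (c , vᶜ) ∷ (d , vᵈ) ∷ l)
    add-boat {vᵃ} {vᵇ} {vᶜ} {vᵈ} newᵃ newᵇ newᶜ newᵈ ab bc cd ca da db = record
      { same-arcs =
          add-same-arcs (a , vᵃ) _
            (add-same-arcs (b , vᵇ) _
              (add-same-arcs (c , vᶜ) _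
                (add-same-arcs (d , vᵈ) _ same-arcs (new-same-arc newᵈ))
                λ { (here refl) → c-d ; (there e∈) → new-same-arc newᶜ e∈ })
              λ { (here refl) → b-c ; (there (here refl)) → b-d ; (there (there e∈)) → new-same-arc newᵇ e∈ })
            λ { (here refl) → a-b ; (there (here refl)) → a-c ; (there (there (here refl))) → a-d
              ; (there (there (there e∈))) → new-same-arc newᵃ e∈ }
      ; closed = λ { placed edge → closed′ (placed⁻ placed) edge }
      ; few = λ { e∈ ¬pl → few′ e∈ ¬pl }
      }
      where
      l′ : List Entry
      l′ = (a , vᵃ) ∷ (b , vᵇ) ∷ (c , vᶜ) ∷ (d , vᵈ) ∷ l
      b<d = <-trans b<c c<d
      ac-edge = proj₁ edges
      ad-edge = proj₁ (proj₂ edges)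
      bd-edge = proj₁ (proj₂ (proj₂ edges))
      ab-none = proj₁ (proj₂ (proj₂ (proj₂ edges)))
      bc-none = proj₁ (proj₂ (proj₂ (proj₂ (proj₂ edges))))
      cd-none = proj₂ (proj₂ (proj₂ (proj₂ (proj₂ edges))))
      a-b : SameArc (a , vᵃ) (b , vᵇ)
      a-b = inj₁ (forward a<b ab-none , ab)
      b-c : SameArc (b , vᵇ) (c , vᶜ)
      b-c = inj₁ (forward b<c bc-none , bc)
      c-d : SameArc (c , vᶜ) (d , vᵈ)
      c-d = inj₁ (forward c<d cd-none , cd)
      a-c : SameArc (a , vᵃ) (c , vᶜ)
      a-c = inj₂ (backward (<-trans a<b b<c) ac-edge , ca)
      a-d : SameArc (a , vᵃ) (d , vᵈ)
      a-d = inj₂ (backward (<-trans a<b b<d) ad-edge , da)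
      b-d : SameArc (b , vᵇ) (d , vᵈ)
      b-d = inj₂ (backward b<d bd-edge , db)
      placed⁻ : ∀ {p} → Placed p l′ → InBoat p ⊎ Placed p l
      placed⁻ (_ , here refl) = inj₁ (inj₁ refl)
      placed⁻ (_ , there (here refl)) = inj₁ (inj₂ (inj₁ refl))
      placed⁻ (_ , there (there (here refl))) = inj₁ (inj₂ (inj₂ (inj₁ refl)))
      placed⁻ (_ , there (there (there (here refl)))) = inj₁ (inj₂ (inj₂ (inj₂ refl)))
      placed⁻ (v , there (there (there (there e∈)))) = inj₂ (v , e∈)
      closed′ : ∀ {p p′} → InBoat p ⊎ Placed p l → BEdge H θ p p′ → Placed p′ l′
      closed′ {p} {p′} (inj₁ p∈) edge =
        boat-placed (Equivalence.to (component p′) (Equivalence.from (component p) p∈ ◅◅ (edge ◅ ε)))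
      closed′ (inj₂ placed) edge = old-placed (closed placed edge)
      few′ : ∀ {e p} → e ∈ₗ l′ → ¬ Placed p l′ → FewExcluded e p
      few′ (here refl) ¬pl = new-few newᵃ (¬pl ∘ boat-placed)
      few′ (there (here refl)) ¬pl = new-few newᵇ (¬pl ∘ boat-placed)
      few′ (there (there (here refl))) ¬pl = new-few newᶜ (¬pl ∘ boat-placed)
      few′ (there (there (there (here refl)))) ¬pl = new-few newᵈ (¬pl ∘ boat-placed)
      few′ (there (there (there (there e∈)))) ¬pl = few e∈ (¬pl ∘ old-placed)

    x-in-boat : InBoat x
    x-in-boat = Equivalence.to (component x) ε

  finish : ∀ {l} → PartialEmbedding l → (∀ p → Placed p l) → ⊥
  finish {l} partial placed = H-free (f , injective , arcs)
    where
    open PartialEmbedding partial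
    f : Fin h → Fin n
    f i = proj₁ (placed (θ ⟨$⟩ˡ i))
    same : ∀ i j → i ≢ j → (Arc H i j × Arc T (f i) (f j)) ⊎ (Arc H j i × Arc T (f j) (f i))
    same i j i≢j = subst₂ (λ i′ j′ → (Arc H i′ j′ × Arc T (f i) (f j)) ⊎ (Arc H j′ i′ × Arc T (f j) (f i)))
      (inverseʳ θ) (inverseʳ θ)
      (same-arcs (proj₂ (placed (θ ⟨$⟩ˡ i))) (proj₂ (placed (θ ⟨$⟩ˡ j)))
        (λ e → i≢j (trans (sym (inverseʳ θ)) (trans (cong (θ ⟨$⟩ʳ_) e) (inverseʳ θ)))))
    injective : ∀ {i j} → f i ≡ f j → i ≡ j
    injective {i} {j} fi≡fj = decidable-stable (i Fin.≟ j) λ i≢j →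
      [ (λ (_ , ij) → arc-irrefl T ij fi≡fj) , (λ (_ , ji) → arc-irrefl T ji (sym fi≡fj)) ] (same i j i≢j)
    arcs : ∀ i j → arc H i j ≡ arc T (f i) (f j)
    arcs i j with i Fin.≟ j
    ... | yes refl = trans (irrefl H i) (sym (irrefl T (f i)))
    ... | no i≢j = [ (λ (ij , ij′) → trans ij (sym ij′))
                   , (λ (ji , ji′) → trans (not-arc H ji) (sym (not-arc T ji′))) ] (same i j i≢j)

  module Find {l : List Entry} (partial : PartialEmbedding l) (short : length l ≤ 4 * h) where
    open PartialEmbedding partial

    V : Fin h → DecSet n
    V = Candidates l

    ∣D∣≤2∣V∣ : ∀ {p} → ¬ Placed p l → ∣ D p ∣ ≤ 2 * ∣ V p ∣
    ∣D∣≤2∣V∣ {p} ¬placed = *-cancelˡ-≤ L (+-cancelʳ-≤ (L * ∣ D p ∣) _ _ (begin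
      L * ∣ D p ∣ + L * ∣ D p ∣                      ≡⟨ cong (L * ∣ D p ∣ +_) (sym (+-identityʳ (L * ∣ D p ∣))) ⟩
      2 * (L * ∣ D p ∣)                              ≤⟨ *-monoʳ-≤ 2 (candidates-large l p (λ e∈ → few e∈ ¬placed)) ⟩
      2 * (L * ∣ V p ∣ + length l * ∣ D p ∣)         ≤⟨ *-monoʳ-≤ 2 (+-monoʳ-≤ (L * ∣ V p ∣) (*-monoˡ-≤ ∣ D p ∣ short)) ⟩
      2 * (L * ∣ V p ∣ + 4 * h * ∣ D p ∣)            ≡⟨ shuffle L (∣ V p ∣) h (∣ D p ∣) ⟩
      L * (2 * ∣ V p ∣) + 8 * h * ∣ D p ∣            ≤⟨ +-monoʳ-≤ (L * (2 * ∣ V p ∣)) (*-monoˡ-≤ ∣ D p ∣ (*-monoʳ-≤ 8 (n≤1+n h))) ⟩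
      L * (2 * ∣ V p ∣) + L * ∣ D p ∣                ∎))
      where
      open ≤-Reasoning
      shuffle : ∀ x v y d → 2 * (x * v + 4 * y * d) ≡ x * (2 * v) + 8 * y * d
      shuffle = solve-∀

    V-large : ∀ {p} → ¬ Placed p l → 64 * ∣ X ∣ ≤ 2 ^ q * ∣ V p ∣
    V-large {p} ¬placed = begin
      64 * ∣ X ∣                     ≤⟨ *-monoʳ-≤ 64 (large p) ⟩
      64 * (C * ∣ D p ∣)             ≤⟨ *-monoʳ-≤ 64 (*-monoʳ-≤ C (∣D∣≤2∣V∣ ¬placed)) ⟩
      64 * (C * (2 * ∣ V p ∣))       ≡⟨ shuffle C ∣ V p ∣ ⟩
      128 * C * ∣ V p ∣              ≤⟨ *-monoˡ-≤ ∣ V p ∣ C-small ⟩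
      2 ^ q * ∣ V p ∣                ∎
      where
      open ≤-Reasoning
      shuffle : ∀ x y → 64 * (x * (2 * y)) ≡ 128 * x * y
      shuffle = solve-∀

    V⊆X : ∀ {p} → V p ⊆ X
    V⊆X {p} v∈ = inside p (candidates⊆D l v∈)

    -- Passing from `D p` to at least half of it at most doubles the density, and `4 ≤ L` still
    -- leaves at most a half.
    V-sparse : ∀ {p} → ¬ Placed p l → {R : Fin n → Set} (R? : ∀ y → Dec (R y)) →
      L * ∣ sep (D p) R? ∣ ≤ ∣ D p ∣ → 2 * ∣ sep (V p) R? ∣ ≤ ∣ V p ∣
    V-sparse {p} ¬placed R? sparse-in-D = *-cancelˡ-≤ 2 (begin
      2 * (2 * ∣ sep (V p) R? ∣)      ≡⟨ sym (*-assoc 2 2 ∣ sep (V p) R? ∣) ⟩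
      4 * ∣ sep (V p) R? ∣            ≤⟨ *-mono-≤ {4} {L} (*-mono-≤ {4} {8} {1} {suc h} (m≤m+n 4 4) (s≤s z≤n))
                                           (∣∣-mono (sep (V p) R?) (sep (D p) R?) (λ (y∈ , r) → candidates⊆D l y∈ , r)) ⟩
      L * ∣ sep (D p) R? ∣            ≤⟨ sparse-in-D ⟩
      ∣ D p ∣                         ≤⟨ ∣D∣≤2∣V∣ ¬placed ⟩
      2 * ∣ V p ∣                     ∎)
      where open ≤-Reasoning

    -- If the boat through `x` could not be added, the candidate sets of its two blocks would
    -- satisfy the hypotheses of `BoatFree`.
    ¬¬-extension : ∀ {x} → ¬ Placed x l →
      (∀ {l′} → PartialEmbedding l′ → length l′ ≡ 4 + length l → (∀ {p} → Placed p l → Placed p l′) → Placed x l′ → ⊥) → ⊥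
    ¬¬-extension {x} ¬placed k = by-boat (components x)
      where
      by-boat : _ → ⊥
      by-boat (a , b , c , d , component , inj₁ (b≡1+a , c≡1+b , c<d , edges)) =
        BoatFree.contradiction T crit (V a) (V d) V⊆X V⊆X
          (λ v∈a v∈d → Sparse.disjoint a-d (candidates⊆D l v∈a) (candidates⊆D l v∈d))
          (V-large unplacedᵃ) (V-large unplacedᵈ)
          (λ {z} z∈ → V-sparse unplacedᵃ (λ y → arc? T z y) (Sparse.right a-d (candidates⊆D l z∈)))
          λ u∈ v∈ w∈ z∈ uv vw wu zu zv wz → continue
            (add-boat
              (record { p∈boat = inj₁ refl ; block = self-block ; v∈ = u∈ })
              (record { p∈boat = inj₂ (inj₁ refl) ; block = next-block (inj₁ refl) b≡1+a self-block ; v∈ = v∈ })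
              (record { p∈boat = inj₂ (inj₂ (inj₁ refl))
                      ; block = next-block (inj₂ (inj₁ refl)) c≡1+b (next-block (inj₁ refl) b≡1+a self-block) ; v∈ = w∈ })
              (record { p∈boat = inj₂ (inj₂ (inj₂ refl)) ; block = self-block ; v∈ = z∈ })
              uv vw wz wu zu zv)
        where
        a<b = ≤-reflexive (sym b≡1+a)
        b<c = ≤-reflexive (sym c≡1+b)
        open Step partial ¬placed component a<b b<c c<d edges
        unplacedᵃ = boat-unplaced (inj₁ refl)
        unplacedᵈ = boat-unplaced (inj₂ (inj₂ (inj₂ refl)))
        a-d : Sparse T L (D a) (D d)
        a-d = sparse a d (<-trans a<b (<-trans b<c c<d))
        continue : ∀ {vᵃ vᵇ vᶜ vᵈ} → PartialEmbedding ((a , vᵃ) ∷ (b , vᵇ) ∷ (c , vᶜ) ∷ (d , vᵈ) ∷ l) → ⊥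
        continue partial′ = k partial′ refl old-placed (boat-placed x-in-boat)
      by-boat (a , b , c , d , component , inj₂ (a<b , c≡1+b , d≡1+c , edges)) =
        -- A right boat reads `d`, `c`, `b`, `a` in the reversed tournament: the triangle `u`, `v`,
        -- `w` goes to `d`, `c`, `b`, all from block `b`, and `z` goes to `a`.
        BoatFree.contradiction (reverse T) (reverse-critical crit) (V b) (V a) V⊆X V⊆X
          (λ v∈b v∈a → Sparse.disjoint a-b (candidates⊆D l v∈a) (candidates⊆D l v∈b))
          (V-large unplacedᵇ) (V-large unplacedᵃ)
          (λ {z} z∈ → V-sparse unplacedᵇ (λ y → arc? T y z) (Sparse.left a-b (candidates⊆D l z∈)))
          λ u∈ v∈ w∈ z∈ vu wv uw uz vz zw → continue
            (add-boat
              (record { p∈boat = inj₁ refl ; block = self-block ; v∈ = z∈ })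
              (record { p∈boat = inj₂ (inj₁ refl) ; block = self-block ; v∈ = w∈ })
              (record { p∈boat = inj₂ (inj₂ (inj₁ refl)) ; block = next-block (inj₂ (inj₁ refl)) c≡1+b self-block ; v∈ = v∈ })
              (record { p∈boat = inj₂ (inj₂ (inj₂ refl))
                      ; block = next-block (inj₂ (inj₂ (inj₁ refl))) d≡1+c (next-block (inj₂ (inj₁ refl)) c≡1+b self-block) ; v∈ = u∈ })
              zw wv vu vz uz uw)
        where
        b<c = ≤-reflexive (sym c≡1+b)
        c<d = ≤-reflexive (sym d≡1+c)
        open Step partial ¬placed component a<b b<c c<d edges
        unplacedᵃ = boat-unplaced (inj₁ refl)
        unplacedᵇ = boat-unplaced (inj₂ (inj₁ refl))
        a-b : Sparse T L (D a) (D b)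
        a-b = sparse a b a<b
        continue : ∀ {vᵃ vᵇ vᶜ vᵈ} → PartialEmbedding ((a , vᵃ) ∷ (b , vᵇ) ∷ (c , vᶜ) ∷ (d , vᵈ) ∷ l) → ⊥
        continue partial′ = k partial′ refl old-placed (boat-placed x-in-boat)

  -- Positions below `k` have been visited; each visit adds one boat or finds its position already
  -- placed, hence the length bound `4 * k`.
  place-from : ∀ j k → k + j ≡ h → ∀ {l} → PartialEmbedding l → length l ≤ 4 * k → (∀ p → toℕ p < k → Placed p l) → ⊥
  place-from zero k k+0≡h partial short placed =
    finish partial λ p → placed p (≤-trans (Fin.toℕ<n p) (≤-reflexive (trans (sym k+0≡h) (+-identityʳ k))))
  place-from (suc j) k k+j≡h {l} partial short placed = step (placed? x l)
    where
    k<h : k < h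
    k<h = ≤-trans (m≤m+n (suc k) j) (≤-reflexive (trans (sym (+-suc k j)) k+j≡h))
    x : Fin h
    x = fromℕ< k<h
    grow : ∀ {l′} → (∀ {p} → Placed p l → Placed p l′) → Placed x l′ → ∀ p → toℕ p < suc k → Placed p l′
    grow {l′} keep x-placed p p<1+k with toℕ p <? k
    ... | yes p<k = keep (placed p p<k)
    ... | no p≮k = subst (λ r → Placed r l′) (Fin.toℕ-injective (trans (Fin.toℕ-fromℕ< k<h)
            (≤-antisym (≮⇒≥ p≮k) (s≤s⁻¹ p<1+k)))) x-placed
    rest : suc k + j ≡ h
    rest = trans (sym (+-suc k j)) k+j≡h
    step : Dec (Placed x l) → ⊥
    step (yes x-placed) = place-from j (suc k) rest partial (≤-trans short (*-monoʳ-≤ 4 (n≤1+n k))) (grow id x-placed)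
    step (no ¬placed) = Find.¬¬-extension partial (≤-trans short (*-monoʳ-≤ 4 (<⇒≤ k<h))) ¬placed
      λ partial′ length≡ keep x-placed → place-from j (suc k) rest partial′
        (≤-trans (≤-reflexive length≡) (≤-trans (+-monoʳ-≤ 4 short) (≤-reflexive (sym (*-suc 4 k)))))
        (grow keep x-placed)

  contradiction : ⊥
  contradiction = place-from h 0 refl {[]} empty z≤n (λ _ ())
    where
    empty : PartialEmbedding []
    empty = record { same-arcs = λ () ; closed = λ { (_ , ()) } ; few = λ () }

-- The induction on vertex subsets

fromSubset : ∀ {n} → Subset.Subset n → DecSet n
fromSubset s = record { Mem = λ x → x Subset.∈ s ; mem? = λ x → x ∈ₛ? s }

toSubset : ∀ {n} → DecSet n → Subset.Subset n
toSubset S = tabulate (λ x → does (x ∈? S))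

toSubset⁺ : ∀ {n} (S : DecSet n) → S ⊆ fromSubset (toSubset S)
toSubset⁺ S {x} x∈S = lookup⇒[]= x (toSubset S) (trans (lookup∘tabulate (λ y → does (y ∈? S)) x) (dec-true (x ∈? S) x∈S))

toSubset⁻ : ∀ {n} (S : DecSet n) → fromSubset (toSubset S) ⊆ S
toSubset⁻ S {x} x∈ = from-does (x ∈? S) (trans (sym (lookup∘tabulate (λ y → does (y ∈? S)) x)) ([]=⇒lookup x∈))
  where
  from-does : ∀ {P : Set} (d : Dec P) → does d ≡ true → P
  from-does (yes p) _ = p
  from-does (no _) ()

root-below : ∀ q N → 0 < N → 0 < q → ∃ λ t → t ^ q < N × N ≤ suc t ^ q
root-below (suc q) N 0<N _ = search N (m≤m^1+q N)
  where
  m≤m^1+q : ∀ m → m ≤ m ^ suc q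
  m≤m^1+q zero = z≤n
  m≤m^1+q (suc m) = ≤-trans (≤-reflexive (sym (*-identityʳ (suc m)))) (*-monoʳ-≤ (suc m) (m^n>0 (suc m) q))
  search : ∀ m → N ≤ m ^ suc q → ∃ λ t → t ^ suc q < N × N ≤ suc t ^ suc q
  search zero N≤0 = ⊥-elim (<-irrefl refl (≤-trans 0<N N≤0))
  search (suc m) N≤ with N ≤? m ^ suc q
  ... | yes N≤m^ = search m N≤m^
  ... | no N≰ = m , ≰⇒> N≰ , N≤

n≤2^n : ∀ n → n ≤ 2 ^ n
n≤2^n zero = z≤n
n≤2^n (suc n) = ≤-trans (+-mono-≤ (m^n>0 2 n) (n≤2^n n)) (≤-reflexive (cong (2 ^ n +_) (sym (+-identityʳ (2 ^ n)))))

module _ {n : ℕ} (T : Tournament n) where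

  LargeTransitive : ℕ → DecSet n → DecSet n → Set
  LargeTransitive q X S = S ⊆ X × TransitiveOn T S × ∣ X ∣ ≤ ∣ S ∣ ^ q

  ⊆? : (S S′ : DecSet n) → Dec (S ⊆ S′)
  ⊆? S S′ = map′ (λ f {x} → f x) (λ f x → f {x}) (Fin.all? λ x → (x ∈? S) →-dec (x ∈? S′))

  transitiveOn? : (S : DecSet n) → Dec (TransitiveOn T S)
  transitiveOn? S = map′ (λ f {x} {y} {w} → f x y w) (λ f x y w → f {x} {y} {w})
    (Fin.all? λ x → Fin.all? λ y → Fin.all? λ w →
      (x ∈? S) →-dec ((y ∈? S) →-dec ((w ∈? S) →-dec (arc? T x y →-dec (arc? T y w →-dec arc? T x w)))))

  large-transitive? : ∀ q X → Dec (∃ λ s → LargeTransitive q X (fromSubset s))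
  large-transitive? q X = anySubset? λ s →
    ⊆? (fromSubset s) X ×-dec (transitiveOn? (fromSubset s) ×-dec (∣ X ∣ ≤? ∣ fromSubset s ∣ ^ q))

  -- Deciding the existence of S by exhaustive search is what makes the classical argument constructive.
  large-transitive-stable : ∀ q X → ((∀ S → ¬ LargeTransitive q X S) → ⊥) → Σ (DecSet n) (LargeTransitive q X)
  large-transitive-stable q X h with large-transitive? q X
  ... | yes (s , large) = fromSubset s , large
  ... | no ∄ = ⊥-elim (h λ S (S⊆X , tr , X≤) → ∄ (toSubset S
        , S⊆X ∘ toSubset⁻ S
        , (λ x∈ y∈ w∈ → tr (toSubset⁻ S x∈) (toSubset⁻ S y∈) (toSubset⁻ S w∈))
        , ≤-trans X≤ (^-monoˡ-≤ q (∣∣-mono S (fromSubset (toSubset S)) (toSubset⁺ S)))))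

  pair-transitive : ∀ u v → TransitiveOn T (⟦ u ⟧ ∪ ⟦ v ⟧)
  pair-transitive u v = acyclic⇒transitive T (⟦ u ⟧ ∪ ⟦ v ⟧) acyclic
    where
    acyclic : ∀ {x y w} → x ∈ ⟦ u ⟧ ∪ ⟦ v ⟧ → y ∈ ⟦ u ⟧ ∪ ⟦ v ⟧ → w ∈ ⟦ u ⟧ ∪ ⟦ v ⟧ → Arc T x y → Arc T y w → Arc T w x → ⊥
    acyclic (inj₁ refl) (inj₁ refl) _ xy yw wx = arc-irrefl T xy refl
    acyclic (inj₂ refl) (inj₂ refl) _ xy yw wx = arc-irrefl T xy refl
    acyclic (inj₁ refl) (inj₂ refl) (inj₁ refl) xy yw wx = arc-irrefl T wx refl
    acyclic (inj₁ refl) (inj₂ refl) (inj₂ refl) xy yw wx = arc-irrefl T yw refl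
    acyclic (inj₂ refl) (inj₁ refl) (inj₁ refl) xy yw wx = arc-irrefl T yw refl
    acyclic (inj₂ refl) (inj₁ refl) (inj₂ refl) xy yw wx = arc-irrefl T wx refl

  -- A set of at most one vertex is itself transitive; otherwise two vertices suffice, because
  -- `∣ X ∣ ≤ 2 ^ q`. Hence a failing set exceeds `2 ^ q`.
  small-set : ∀ q X → 0 < q → ∣ X ∣ ≤ 2 ^ q → ¬ (∀ S → ¬ LargeTransitive q X S)
  small-set (suc q) X _ X≤2^q none with 2 ≤? ∣ X ∣
  ... | no 2≰X = none X (id , transitive , ≤1⇒≤^ ∣ X ∣ (≤-pred (≰⇒> 2≰X)))
    where
    transitive : TransitiveOn T X
    transitive {x} {y} x∈ y∈ _ xy _ = ⊥-elim (2≰X (≤-trans (s≤s (1≤∣∣ ⟦ x ⟧ refl))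
      (∣∣-strict ⟦ x ⟧ X (λ { refl → x∈ }) y∈ (arc-irrefl T xy ∘ sym))))
    ≤1⇒≤^ : ∀ m → m ≤ 1 → m ≤ m ^ suc q
    ≤1⇒≤^ zero _ = z≤n
    ≤1⇒≤^ (suc zero) _ = ≤-reflexive (sym (^-zeroˡ (suc q)))
    ≤1⇒≤^ (suc (suc m)) (s≤s ())
  ... | yes 2≤X =
    let u , u∈X = inhabited X (≤-trans (s≤s z≤n) 2≤X)
        v , v∈X , v∉ = inhabited (X ∖ ⟦ u ⟧) (+-cancelˡ-≤ 1 _ _ (≤-trans 2≤X (≤-trans (∣∣-∖ X ⟦ u ⟧) (+-monoˡ-≤ ∣ X ∖ ⟦ u ⟧ ∣ (∣⟦⟧∣≤1 u)))))
    in none (⟦ u ⟧ ∪ ⟦ v ⟧)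
      ( (λ { (inj₁ refl) → u∈X ; (inj₂ refl) → v∈X })
      , pair-transitive u v
      , ≤-trans X≤2^q (^-monoˡ-≤ (suc q) (≤-trans (s≤s (1≤∣∣ ⟦ u ⟧ refl)) (∣∣-strict ⟦ u ⟧ (⟦ u ⟧ ∪ ⟦ v ⟧) inj₁ (inj₂ refl) v∉))))

  -- `t` is the `q`-th root of `∣ X ∣` rounded so that `t ^ q < ∣ X ∣ ≤ suc t ^ q`; a transitive set
  -- of more than `t` vertices would be large enough.
  critical : ∀ q X → 0 < q → (∀ S → ¬ LargeTransitive q X S) →
    (∀ Y → Y ⊆ X → ∣ Y ∣ < ∣ X ∣ → Σ (DecSet n) (LargeTransitive q Y)) → ∃ λ t → Critical T X q t
  critical q X 0<q none smaller =
    let 2^q<X = ≰⇒> (λ X≤ → small-set q X 0<q X≤ none)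
        t , t^q<X , X≤ = root-below q ∣ X ∣ (≤-<-trans z≤n 2^q<X) 0<q
    in t , record
      { bounded = λ S S⊆X tr → ≮⇒≥ λ t<S → none S (S⊆X , tr , ≤-trans X≤ (^-monoˡ-≤ q t<S))
      ; smaller = smaller
      ; t^q<∣X∣ = t^q<X
      ; 2^q≤∣X∣ = <⇒≤ 2^q<X
      }

  transitiveOn⇒HasTransitiveSub : ∀ S → TransitiveOn T S → HasTransitiveSub T ∣ S ∣
  transitiveOn⇒HasTransitiveSub S tr =
    let f , injective , f∈S = enumerate S in f , injective , λ (m , w , path , back) →
      acyclic (f ∘ w) (λ i → f∈S (w i)) path back
    where
    -- Transitivity collapses a path to one arc, so that a longer directed cycle becomes a pair of
    -- opposite arcs.
    last-arc : ∀ {m} (w : Fin (suc (suc m)) → Fin n) → (∀ i → w i ∈ S) →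
      (∀ i → Arc T (w (inject₁ i)) (w (fsuc i))) → Arc T (w fzero) (w (fromℕ (suc m)))
    last-arc {zero} w w∈S path = path fzero
    last-arc {suc m} w w∈S path =
      tr (w∈S _) (w∈S _) (w∈S _) (path fzero) (last-arc (λ i → w (fsuc i)) (λ i → w∈S (fsuc i)) (λ i → path (fsuc i)))
    acyclic : ∀ {m} (w : Fin (suc m) → Fin n) → (∀ i → w i ∈ S) →
      (∀ (i : Fin m) → Arc T (w (inject₁ i)) (w (fsuc i))) → Arc T (w (fromℕ m)) (w fzero) → ⊥
    acyclic {zero} w w∈S path back = arc-irrefl T back refl
    acyclic {suc m} w w∈S path back = arc-asym T back (last-arc w w∈S path)

module _ {h : ℕ} (H : Tournament h) (flotilla : Flotilla H) where

  -- By `n≤2^n`, an exponent of at least `128 * C` ensures `C-small`; the resulting `q` depends on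
  -- `h` alone.
  C q′ q : ℕ
  C = block-constant h (8 * suc h) h
  q′ = 128 * C
  q = 2 + q′

  C-small : 128 * C ≤ 2 ^ q
  C-small = ≤-trans (n≤2^n (128 * C)) (^-monoʳ-≤ 2 (m≤n+m q′ 2))

  -- Strong induction on `∣ X ∣` through `fuel`: if `X` fails while all smaller subsets succeed, it
  -- is critical, and its blocks would yield a copy of `H`.
  large-transitive : ∀ {n} (T : Tournament n) → ¬ Contains T H → ∀ fuel X → ∣ X ∣ ≤ fuel →
    Σ (DecSet n) (LargeTransitive T q X)
  large-transitive T H-free zero X X≤0 = ∅ , (λ ()) , (λ ()) , ≤-trans X≤0 z≤n
  large-transitive T H-free (suc fuel) X X≤ = large-transitive-stable T q X λ none →
    let t , crit = critical T q X (s≤s z≤n) none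
                     (λ Y _ Y<X → large-transitive T H-free fuel Y (≤-pred (≤-trans Y<X X≤)))
    in ¬¬-blocks T H H-free (8 * suc h) (s≤s z≤n) h X
         (≤-trans (≤-trans (m≤m+n C (127 * C)) C-small) (Critical.2^q≤∣X∣ crit))
         λ D blocks → Embedding.contradiction T H H-free (proj₁ flotilla) (proj₂ flotilla) crit C-small D blocks

theorem5 : ∀ {h} (H : Tournament h) → Flotilla H →
    Σ ℕ λ p → Σ ℕ λ q → 0 < p × 0 < q ×
    (∀ n (T : Tournament n) → ¬ Contains T H →
    Σ ℕ λ k → HasTransitiveSub T k × n ^ p ≤ k ^ q)
-- The exponent is `1 / q`: the inequality `n ^ 1 ≤ k ^ q` says `k ≥ n ^ (1 / q)`.
theorem5 H flotilla = 1 , q H flotilla , s≤s z≤n , s≤s z≤n , λ n T H-free →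
  let S , _ , transitive , n≤ = large-transitive H flotilla T H-free n all (∣∣≤n all)
  in ∣ S ∣ , transitiveOn⇒HasTransitiveSub T S transitive
   , ≤-trans (≤-reflexive (trans (*-identityʳ n) (sym ∣all∣))) n≤
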